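{- Testing uniformity requires at least $\Omega(\log\log n)$ non-adaptive conditional samples for some fixed $\epsilon$. That is, there exist constants $\epsilon>0$ and $c>0$ such that for all sufficiently large $n$, every non-adaptive distribution tester for the property of being the uniform distribution over $[n]$, with distance parameter $\epsilon$ and error bound $\delta=\frac13$, must use at least $c\log\log n$ conditional samples.
   Context: $[n]=\{1,\ldots,n\}$; the variation distance is $d(\mu,\mu')=\frac12\sum_{i=1}^n|\mu(i)-\mu'(i)|$. A conditional sampling oracle for a distribution $\mu$ over $[n]$ takes a nonempty set $A\subseteq[n]$ and returns $j\in A$ with probability $\mu(j)/\mu(A)$ if $\mu(A)>0$, and a uniformly random member of $A$ if $\mu(A)=0$, independently of all previous samples. A non-adaptive distribution tester for uniformity (with parameters $\epsilon,\delta,n$) is a randomized algorithm that first generates, before receiving any sample, sets $A_1,\ldots,A_t\subseteq[n]$, then receives $j_1,\ldots,j_t$, where $j_i$ is the oracle's answer on $A_i$, and then accepts or rejects based on $j_1,\ldots,j_t$ and its internal coin tosses. It must accept with probability at least $1-\delta$ if $\mu$ is the uniform distribution over $[n]$, and reject with probability at least $1-\delta$ if $d(\mu,\mu')\ge\epsilon$ for $\mu'$ the uniform distribution over $[n]$. The number of samples it uses is $t$. -}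

module Defs where

open import Algebra.Apartness.Structures using (IsHeytingField)
open import Algebra.Bundles using (CommutativeRing)
open import Algebra.Core using (Op₁; Op₂)
import Algebra.Definitions.RawMonoid as RawMonoidDefinitions
open import Data.Bool using (Bool; if_then_else_)
open import Data.Fin using (Fin)
open import Data.Fin.Subset using (Subset; Nonempty; _∈_; _∉_; ∣_∣)
open import Data.Fin.Subset.Properties using (x∈p⇒∣p-x∣<∣p∣)
open import Data.Nat as ℕ using (ℕ; zero; suc; NonZero; z≤n; >-nonZero)
open import Data.Nat.Properties using (≤-<-trans)
open import Data.Product using (∃; ∃-syntax; _,_; proj₁)
open import Data.Sum using (_⊎_; inj₁; inj₂)
open import Data.Vec using (Vec; []; _∷_; lookup)
open import Function using (_∘_)
open import Level using (Level; _⊔_) renaming (suc to lsuc)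
open import Relation.Binary.Core using (Rel)
open import Relation.Binary.Lattice.Definitions using (Supremum)
open import Relation.Binary.Structures using (IsStrictPartialOrder)
open import Relation.Nullary using (¬_)

-- The standard library has no real numbers, so probabilities are taken in an
-- arbitrary Archimedean ordered field, of which ℝ is an instance. Only finite
-- sums, products and quotients of probabilities occur below, so completeness
-- is never used. The axioms do not make the order decidable, so that they hold
-- for the classical as well as for the constructive (Cauchy or Dedekind) reals.

record ArchimedeanOrderedField (c ℓ₁ ℓ₂ : Level) : Set (lsuc (c ⊔ ℓ₁ ⊔ ℓ₂)) where
  infix  8 -_
  infixl 7 _*_
  infixl 6 _+_
  infixl 6 _∨_
  infix  4 _≈_ _<_ _≤_ _#_

  field
    Carrier : Set c
    _≈_     : Rel Carrier ℓ₁
    _<_     : Rel Carrier ℓ₂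
    _+_     : Op₂ Carrier
    _*_     : Op₂ Carrier
    -_      : Op₁ Carrier
    0#      : Carrier
    1#      : Carrier
    _∨_     : Op₂ Carrier

  _#_ : Rel Carrier ℓ₂
  x # y = x < y ⊎ y < x

  _≤_ : Rel Carrier ℓ₂
  x ≤ y = ¬ (y < x)

  field
    isHeytingField         : IsHeytingField _≈_ _#_ _+_ _*_ -_ 0# 1#
    <-isStrictPartialOrder : IsStrictPartialOrder _≈_ _<_
    +-monoʳ-<              : ∀ x {y z} → y < z → x + y < x + z
    *-pos                  : ∀ {x y} → 0# < x → 0# < y → 0# < x * y
    0<1                    : 0# < 1#
    ∨-supremum             : Supremum _≤_ _∨_

  open IsHeytingField isHeytingField public
  open IsStrictPartialOrder <-isStrictPartialOrder public
    using (<-resp-≈; <-respʳ-≈; <-respˡ-≈)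
    renaming (irrefl to <-irrefl; trans to <-trans; asym to <-asym)

  commutativeRing : CommutativeRing c ℓ₁
  commutativeRing = record { isCommutativeRing = isCommutativeRing }

  open RawMonoidDefinitions (CommutativeRing.+-rawMonoid commutativeRing) public
    using (sum) renaming (_×_ to _·_)

  fromℕ : ℕ → Carrier
  fromℕ n = n · 1#

  field
    archimedean : ∀ x → ∃[ n ] x < fromℕ n

  ∣_∣ᶠ : Carrier → Carrier
  ∣ x ∣ᶠ = x ∨ (- x)

  _⁻¹⟨_⟩ : ∀ x → 0# < x → Carrier
  x ⁻¹⟨ 0<x ⟩ = proj₁ (#⇒invertible {x} {0#} (inj₂ 0<x))

  _/_⟨_⟩ : Carrier → ∀ y → 0# < y → Carrier
  x / y ⟨ 0<y ⟩ = x * (y ⁻¹⟨ 0<y ⟩)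

  0<fromℕ : ∀ n → .{{NonZero n}} → 0# < fromℕ n
  0<fromℕ (suc zero)    = <-respʳ-≈ (sym (+-identityʳ 1#)) 0<1
  0<fromℕ (suc (suc n)) =
    <-trans 0<1 (<-respˡ-≈ (+-identityʳ 1#) (+-monoʳ-< 1# (0<fromℕ (suc n))))

  1/_ : ∀ n → .{{NonZero n}} → Carrier
  1/ n = 1# / fromℕ n ⟨ 0<fromℕ n ⟩

nonempty⇒nonZero : ∀ {n} {A : Subset n} → Nonempty A → NonZero ∣ A ∣
nonempty⇒nonZero (_ , x∈A) = >-nonZero (≤-<-trans z≤n (x∈p⇒∣p-x∣<∣p∣ x∈A))

module UniformityTesting {c ℓ₁ ℓ₂} (R : ArchimedeanOrderedField c ℓ₁ ℓ₂) where

  open ArchimedeanOrderedField R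

  record Distribution (n : ℕ) : Set (c ⊔ ℓ₁ ⊔ ℓ₂) where
    field
      prob    : Fin n → Carrier
      nonNeg  : ∀ i → 0# ≤ prob i
      total≈1 : sum prob ≈ 1#

  open Distribution public

  measure : ∀ {n} → Distribution n → Subset n → Carrier
  measure μ A = sum λ i → if lookup A i then prob μ i else 0#

  distance : ∀ {n} → Distribution n → Distribution n → Carrier
  distance μ μ′ = 1/ 2 * sum λ i → ∣ prob μ i - prob μ′ i ∣ᶠ

  IsUniform : ∀ {n} → .{{NonZero n}} → Distribution n → Set ℓ₁
  IsUniform {n} μ = ∀ i → prob μ i ≈ 1/ n

  Query : ℕ → Set
  Query n = ∃ (Nonempty {n})

  Oracle : ℕ → Set (c ⊔ ℓ₁ ⊔ ℓ₂)
  Oracle n = Query n → Distribution n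

  -- Since the order need not be decidable, an oracle for μ is specified by the
  -- two cases μ(A) > 0 and μ(A) = 0 rather than computed from μ. The
  -- specification determines all answer probabilities up to _≈_.
  record IsConditionalOracle {n} (μ : Distribution n) (O : Oracle n)
    : Set (c ⊔ ℓ₁ ⊔ ℓ₂) where
    field
      outside  : ∀ A (ne : Nonempty A) {j} → j ∉ A → prob (O (A , ne)) j ≈ 0#
      positive : ∀ A (ne : Nonempty A) (0<μA : 0# < measure μ A) {j} → j ∈ A →
                 prob (O (A , ne)) j ≈ prob μ j / measure μ A ⟨ 0<μA ⟩
      null     : ∀ A (ne : Nonempty A) → measure μ A ≈ 0# → ∀ {j} → j ∈ A →
                 prob (O (A , ne)) j ≈ (1/ ∣ A ∣) {{nonempty⇒nonZero ne}}

  -- All internal randomness is drawn at the start as one element of a finite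
  -- probability space with arbitrary weights. This loses no generality: for
  -- given n and t there are finitely many deterministic testers, and every
  -- randomized one induces a distribution on them.
  record Tester (n t : ℕ) : Set (c ⊔ ℓ₁ ⊔ ℓ₂) where
    field
      #coins  : ℕ
      coin    : Distribution #coins
      queries : Fin #coins → Vec (Query n) t
      accepts : Fin #coins → Vec (Fin n) t → Bool

  -- The expectation of f(j₁,…,jₜ), where jᵢ is drawn from O(Aᵢ) independently.
  expectation : ∀ {n t} → Oracle n → Vec (Query n) t → (Vec (Fin n) t → Carrier) → Carrier
  expectation O []       f = f []
  expectation O (A ∷ As) f = sum λ j → prob (O A) j * expectation O As (f ∘ (j ∷_))

  acceptProb rejectProb : ∀ {n t} → Tester n t → Oracle n → Carrier
  acceptProb T O = sum λ ω → prob coin ω *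
    expectation O (queries ω) (λ js → if accepts ω js then 1# else 0#)
    where open Tester T
  rejectProb T O = sum λ ω → prob coin ω *
    expectation O (queries ω) (λ js → if accepts ω js then 0# else 1#)
    where open Tester T

  record IsUniformityTester {n t} .{{_ : NonZero n}} (ε δ : Carrier) (T : Tester n t)
    : Set (c ⊔ ℓ₁ ⊔ ℓ₂) where
    field
      completeness : ∀ μ O → IsUniform μ → IsConditionalOracle μ O →
                     1# - δ ≤ acceptProb T O
      soundness    : ∀ μ μ′ O → IsUniform μ′ → IsConditionalOracle μ O →
                     ε ≤ distance μ μ′ → 1# - δ ≤ rejectProb T O

{-# OPTIONS --safe #-}
module Submission where

-- The hard instances live at a random scale M = 2^k. Let S contain each element
-- of [n] independently with probability 1/M, and let μ be uniform on S. If S is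
-- nonempty and has at most n/2 elements, then μ is far from uniform and has to be
-- rejected. Yet an answer to a query A tells μ from the uniform distribution only
-- if the size of A is close to M: when A is much smaller, S misses A and the
-- convention for null sets makes the answer uniform in A; when A is much larger,
-- S ∩ A is a large random sample of A, and one random element of it is again
-- uniform in A. Queries that are fixed in advance can be close to few of the
-- log n scales only.
--
-- To make this quantitative, the probability of every vector of answers under μ
-- is compared with the one under the uniform distribution, from below only. A
-- single answer is treated in oracle-lower-bound. Restricting the mean over S to
-- the sets containing j is the same as inserting j into S, up to the factor 1/M
-- (𝔼-∈), so the answers to large queries may be taken uniform and planted in S;
-- this leads to expectation-lower-bound. What is left there is a product of
-- inverses of the relative densities of S in the large queries, times the
-- indicator that S misses the small ones. The inequality of arithmetic and
-- geometric means bounds this product below by an affine function of the numbers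
-- |S ∩ A| (likelihood-lower-bound). Means of affine functions are explicit, hence
-- no concentration inequality is needed.
--
-- The outcome is indistinguishable: the acceptance probability under the uniform
-- distribution exceeds the mean one under μ by at most a polynomial in the number
-- of queries times the sum of the rates of the queries and of similar terms, the
-- rate being M/|A| or |A|/M, according to whether M ≤ |A|. For one query the rates
-- at all scales sum up to at most 4 (sum-rate-≤4). A tester has to bridge a gap of
-- 1/3 at each scale, so the number of scales is at most a cubic polynomial in the
-- number of queries (scales-≤). This gives a lower bound of order (log n)^(1/3),
-- more than log log n.

open import Defs
open import Algebra.Bundles using (CommutativeRing)
import Algebra.Properties.CommutativeMonoid.Sum as SumProperties
import Algebra.Properties.Monoid.Mult as MultProperties
import Algebra.Properties.Ring as RingProperties
import Algebra.Properties.Semiring.Exp as SemiringExp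
import Algebra.Properties.Semiring.Mult as SemiringMultProperties
import Algebra.Properties.Semiring.Sum as SemiringSumProperties
import Algebra.Solver.Ring.NaturalCoefficients.Default as Solver
open import Data.Bool using (Bool; true; false; if_then_else_; _∧_; not) renaming (T to IsTrue)
open import Data.Empty using (⊥-elim)
open import Data.Fin using (Fin; zero; suc; toℕ)
open import Data.Fin.Properties using (toℕ<n)
open import Data.Fin.Subset using (Subset; inside; outside; Nonempty; _∈_; _∉_; _∩_; ∣_∣; ⊤; ∁)
open import Data.Fin.Subset.Properties
  using (nonempty?; Empty-unique; ∣⊥∣≡0; ∈⊤; ∣⊤∣≡n; ∩-identityˡ; ∩-identityʳ; p∩q⊆q; ∣∁p∣≡n∸∣p∣;
         x∈p⇒∣p-x∣<∣p∣)
open import Data.Nat as ℕ using (ℕ; zero; suc; NonZero; z≤n; s≤s)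
open import Data.Nat.Logarithm using (⌈log₂_⌉; ⌈log₂⌉-mono-≤; ⌈log₂2^n⌉≡n)
import Data.Nat.Properties as ℕₚ
open import Data.Nat.Tactic.RingSolver using (solve-∀)
open import Data.Product using (∃-syntax; _×_; _,_; proj₁; proj₂)
open import Data.Sum using (_⊎_; inj₁; inj₂)
open import Data.Unit using (tt)
open import Data.Vec using (Vec; []; _∷_; lookup; tail; _[_]≔_)
open import Data.Vec.Properties
  using (lookup-zipWith; lookup-map; lookup∘updateAt; []=⇒lookup; lookup⇒[]=)
open import Function using (_∘_)
open import Relation.Binary.Bundles using (Poset)
import Relation.Binary.Reasoning.PartialOrder as PosetReasoning
open import Relation.Binary.PropositionalEquality as ≡ using (_≡_)
open import Relation.Nullary using (¬_; yes; no; does)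

-- Ordered fields

module OrderedFieldProperties {c ℓ₁ ℓ₂} (R : ArchimedeanOrderedField c ℓ₁ ℓ₂) where

  open ArchimedeanOrderedField R hiding (zero)
  open CommutativeRing commutativeRing public
    using (ring; semiring; commutativeSemiring; +-commutativeMonoid; +-monoid)
  open SumProperties +-commutativeMonoid public
    using (sum-cong-≋; ∑-distrib-+; ∑-comm)
  open SemiringSumProperties semiring public using (*-distribˡ-sum; *-distribʳ-sum)
  open SemiringExp semiring public using (_^_)
  open Solver commutativeSemiring public using (solve; _:=_; _:+_; _:*_; con)

  ≤-refl : ∀ {x} → x ≤ x
  ≤-refl = <-irrefl refl

  ≤-reflexive : ∀ {x y} → x ≈ y → x ≤ y
  ≤-reflexive x≈y y<x = <-irrefl (sym x≈y) y<x

  <⇒≤ : ∀ {x y} → x < y → x ≤ y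
  <⇒≤ = <-asym

  -- Cotransitivity of the apartness locates the middle element relative to the
  -- outer ones.
  ≤-trans : ∀ {x y z} → x ≤ y → y ≤ z → x ≤ z
  ≤-trans {x} {y} x≤y y≤z z<x with #-cotrans (inj₁ z<x) y
  ... | inj₁ (inj₁ z<y) = y≤z z<y
  ... | inj₁ (inj₂ y<z) = x≤y (<-trans y<z z<x)
  ... | inj₂ (inj₁ y<x) = x≤y y<x
  ... | inj₂ (inj₂ x<y) = y≤z (<-trans z<x x<y)

  ≤-antisym : ∀ {x y} → x ≤ y → y ≤ x → x ≈ y
  ≤-antisym {x} {y} x≤y y≤x =
    proj₁ (tight x y) λ { (inj₁ x<y) → y≤x x<y ; (inj₂ y<x) → x≤y y<x }

  poset : Poset c ℓ₁ ℓ₂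
  poset = record
    { Carrier = Carrier ; _≈_ = _≈_ ; _≤_ = _≤_
    ; isPartialOrder = record
      { isPreorder = record
        { isEquivalence = isEquivalence ; reflexive = ≤-reflexive ; trans = ≤-trans }
      ; antisym = ≤-antisym } }

  module ≤-Reasoning = PosetReasoning poset

  open RingProperties ring public using (-‿involutive; -‿distribʳ-*; -‿distribˡ-*; -0#≈0#)

  x-0≈x : ∀ x → x - 0# ≈ x
  x-0≈x x = trans (+-congˡ -0#≈0#) (+-identityʳ x)

  -- Order and addition

  +-cancel-neg : ∀ z x → - z + (z + x) ≈ x
  +-cancel-neg z x = trans (sym (+-assoc (- z) z x))
    (trans (+-congʳ (-‿inverseˡ z)) (+-identityˡ x))

  +-cancelˡ-< : ∀ z {x y} → z + x < z + y → x < y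
  +-cancelˡ-< z {x} {y} lt = <-respˡ-≈ (+-cancel-neg z x)
    (<-respʳ-≈ (+-cancel-neg z y) (+-monoʳ-< (- z) lt))

  +-monoʳ-≤ : ∀ z {x y} → x ≤ y → z + x ≤ z + y
  +-monoʳ-≤ z x≤y lt = x≤y (+-cancelˡ-< z lt)

  +-cancelˡ-≤ : ∀ z {x y} → z + x ≤ z + y → x ≤ y
  +-cancelˡ-≤ z le lt = le (+-monoʳ-< z lt)

  +-mono-≤ : ∀ {w x y z} → w ≤ x → y ≤ z → w + y ≤ x + z
  +-mono-≤ {w} {x} {y} {z} w≤x y≤z = ≤-trans (+-monoʳ-≤ w y≤z)
    (≤-trans (≤-reflexive (+-comm w z))
      (≤-trans (+-monoʳ-≤ z w≤x) (≤-reflexive (+-comm z x))))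

  +-monoˡ-≤ : ∀ z {x y} → x ≤ y → x + z ≤ y + z
  +-monoˡ-≤ z x≤y = +-mono-≤ x≤y ≤-refl

  +-cancelʳ-≤ : ∀ z {x y} → x + z ≤ y + z → x ≤ y
  +-cancelʳ-≤ z {x} {y} le = +-cancelˡ-≤ z
    (≤-trans (≤-reflexive (+-comm z x)) (≤-trans le (≤-reflexive (+-comm y z))))

  +-nonNeg : ∀ {x y} → 0# ≤ x → 0# ≤ y → 0# ≤ x + y
  +-nonNeg 0≤x 0≤y = ≤-trans (≤-reflexive (sym (+-identityʳ 0#))) (+-mono-≤ 0≤x 0≤y)

  x≤x+y : ∀ {x y} → 0# ≤ y → x ≤ x + y
  x≤x+y {x} 0≤y = ≤-trans (≤-reflexive (sym (+-identityʳ x))) (+-monoʳ-≤ x 0≤y)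

  y≤x+y : ∀ {x y} → 0# ≤ x → y ≤ x + y
  y≤x+y {x} {y} 0≤x = ≤-trans (x≤x+y 0≤x) (≤-reflexive (+-comm y x))

  x-y+y≈x : ∀ x y → x - y + y ≈ x
  x-y+y≈x x y = trans (+-assoc x (- y) y) (trans (+-congˡ (-‿inverseˡ y)) (+-identityʳ x))

  x≤y⇒0≤y-x : ∀ {x y} → x ≤ y → 0# ≤ y - x
  x≤y⇒0≤y-x {x} {y} x≤y = +-cancelʳ-≤ x (≤-trans (≤-reflexive (+-identityˡ x))
    (≤-trans x≤y (≤-reflexive (sym (x-y+y≈x y x)))))

  0≤y-x⇒x≤y : ∀ {x y} → 0# ≤ y - x → x ≤ y
  0≤y-x⇒x≤y {x} {y} le = ≤-trans (≤-reflexive (sym (+-identityˡ x)))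
    (≤-trans (+-monoˡ-≤ x le) (≤-reflexive (x-y+y≈x y x)))

  0≤-x : ∀ {x} → x ≤ 0# → 0# ≤ - x
  0≤-x {x} x≤0 = ≤-trans (x≤y⇒0≤y-x x≤0) (≤-reflexive (+-identityˡ (- x)))

  0≤1 : 0# ≤ 1#
  0≤1 = <⇒≤ 0<1

  -- Order and multiplication

  nonZero⇒#0 : ∀ {x y} → x * y ≈ 1# → x # 0#
  nonZero⇒#0 {x} {y} xy≈1 = invertible⇒# (y ,
    trans (*-congˡ (x-0≈x x)) (trans (*-comm y x) xy≈1) ,
    trans (*-congʳ (x-0≈x x)) xy≈1)

  -- A negative product would be invertible, hence so would both factors, and a
  -- nonnegative invertible number is positive.
  *-nonNeg : ∀ {x y} → 0# ≤ x → 0# ≤ y → 0# ≤ x * y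
  *-nonNeg {x} {y} 0≤x 0≤y xy<0 with #⇒invertible (inj₁ xy<0)
  ... | z , _ , xy-0*z≈1 with nonZero⇒#0 {x} {y * z} x-inv | nonZero⇒#0 {y} {x * z} y-inv
    where
    xyz≈1 : x * y * z ≈ 1#
    xyz≈1 = trans (*-congʳ (sym (x-0≈x (x * y)))) xy-0*z≈1
    x-inv : x * (y * z) ≈ 1#
    x-inv = trans (sym (*-assoc x y z)) xyz≈1
    y-inv : y * (x * z) ≈ 1#
    y-inv = trans (solve 3 (λ x y z → y :* (x :* z) := x :* y :* z) refl x y z) xyz≈1
  ... | inj₁ x<0 | _        = 0≤x x<0
  ... | inj₂ 0<x | inj₁ y<0 = 0≤y y<0
  ... | inj₂ 0<x | inj₂ 0<y = <-asym xy<0 (*-pos 0<x 0<y)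

  *-monoʳ-≤ : ∀ z {x y} → 0# ≤ z → x ≤ y → z * x ≤ z * y
  *-monoʳ-≤ z {x} {y} 0≤z x≤y = 0≤y-x⇒x≤y (≤-trans (*-nonNeg 0≤z (x≤y⇒0≤y-x x≤y))
    (≤-reflexive (trans (distribˡ z y (- x)) (+-congˡ (sym (-‿distribʳ-* z x))))))

  *-monoˡ-≤ : ∀ z {x y} → 0# ≤ z → x ≤ y → x * z ≤ y * z
  *-monoˡ-≤ z {x} {y} 0≤z x≤y = ≤-trans (≤-reflexive (*-comm x z))
    (≤-trans (*-monoʳ-≤ z 0≤z x≤y) (≤-reflexive (*-comm z y)))

  *-mono-≤ : ∀ {w x y z} → 0# ≤ w → 0# ≤ z → w ≤ x → y ≤ z → w * y ≤ x * z
  *-mono-≤ {w} {x} {y} {z} 0≤w 0≤z w≤x y≤z = ≤-trans (*-monoʳ-≤ w 0≤w y≤z) (*-monoˡ-≤ z 0≤z w≤x)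

  -- Inequalities are negations, so classical case distinctions may be made when
  -- proving them.
  ≤-cases : ∀ {x y u v} → (x ≤ y → u ≤ v) → (y ≤ x → u ≤ v) → u ≤ v
  ≤-cases f g lt = f (λ y<x → g (<⇒≤ y<x) lt) lt

  square-nonNeg : ∀ x → 0# ≤ x * x
  square-nonNeg x = ≤-cases {x} {0#}
    (λ x≤0 → ≤-trans (*-nonNeg (0≤-x x≤0) (0≤-x x≤0)) (≤-reflexive neg²))
    (λ 0≤x → *-nonNeg 0≤x 0≤x)
    where
    neg² : - x * - x ≈ x * x
    neg² = trans (sym (-‿distribʳ-* (- x) x))
      (trans (-‿cong (sym (-‿distribˡ-* x x))) (-‿involutive (x * x)))

  -- Natural numbers and their inverses

  fromℕ-+ : ∀ m n → fromℕ (m ℕ.+ n) ≈ fromℕ m + fromℕ n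
  fromℕ-+ = MultProperties.×-homo-+ +-monoid 1#

  fromℕ-* : ∀ m n → fromℕ (m ℕ.* n) ≈ fromℕ m * fromℕ n
  fromℕ-* = SemiringMultProperties.×1-homo-* semiring

  fromℕ-1 : fromℕ 1 ≈ 1#
  fromℕ-1 = +-identityʳ 1#

  fromℕ-nonNeg : ∀ n → 0# ≤ fromℕ n
  fromℕ-nonNeg zero    = ≤-refl
  fromℕ-nonNeg (suc n) = <⇒≤ (0<fromℕ (suc n))

  fromℕ-mono : ∀ {m n} → m ℕ.≤ n → fromℕ m ≤ fromℕ n
  fromℕ-mono {n = n} z≤n = fromℕ-nonNeg n
  fromℕ-mono (s≤s m≤n)   = +-monoʳ-≤ 1# (fromℕ-mono m≤n)

  fromℕ-mono-< : ∀ {m n} → m ℕ.< n → fromℕ m < fromℕ n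
  fromℕ-mono-< {zero}  {suc n} _         = 0<fromℕ (suc n)
  fromℕ-mono-< {suc m} {suc n} (s≤s m<n) = +-monoʳ-< 1# (fromℕ-mono-< m<n)

  *-inverseʳ : ∀ {x} (0<x : 0# < x) → x * x ⁻¹⟨ 0<x ⟩ ≈ 1#
  *-inverseʳ {x} 0<x = trans (*-congʳ (sym (x-0≈x x))) (proj₂ (proj₂ (#⇒invertible (inj₂ 0<x))))

  inverse-nonNeg : ∀ {x y} → 0# ≤ x → x * y ≈ 1# → 0# ≤ y
  inverse-nonNeg {x} {y} 0≤x xy≈1 = ≤-trans (*-nonNeg 0≤x (square-nonNeg y))
    (≤-reflexive (trans (sym (*-assoc x y y)) (trans (*-congʳ xy≈1) (*-identityˡ y))))

  -- Total, so that the sizes of possibly empty sets can be inverted; the value at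
  -- zero is a convention.
  inv : ℕ → Carrier
  inv zero    = 0#
  inv (suc n) = 1/ (suc n)

  1/-irrelevant : ∀ n .{{_ : NonZero n}} → 1/ n ≈ inv n
  1/-irrelevant (suc n) = refl

  fromℕ-inv : ∀ n .{{_ : NonZero n}} → fromℕ n * inv n ≈ 1#
  fromℕ-inv (suc n) = trans (*-congˡ (*-identityˡ _)) (*-inverseʳ (0<fromℕ (suc n)))

  inv-nonNeg : ∀ n → 0# ≤ inv n
  inv-nonNeg zero    = ≤-refl
  inv-nonNeg (suc n) = inverse-nonNeg (fromℕ-nonNeg (suc n)) (fromℕ-inv (suc n))

  fromℕ-inv-≤1 : ∀ n → fromℕ n * inv n ≤ 1#
  fromℕ-inv-≤1 zero    = ≤-trans (≤-reflexive (zeroˡ _)) 0≤1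
  fromℕ-inv-≤1 (suc n) = ≤-reflexive (fromℕ-inv (suc n))

  inverse-unique : ∀ {x y z} → x * y ≈ 1# → x * z ≈ 1# → y ≈ z
  inverse-unique {x} {y} {z} xy≈1 xz≈1 = begin
    y           ≈⟨ *-identityʳ y ⟨
    y * 1#      ≈⟨ *-congˡ xz≈1 ⟨
    y * (x * z) ≈⟨ solve 3 (λ x y z → y :* (x :* z) := x :* y :* z) refl x y z ⟩
    x * y * z   ≈⟨ *-congʳ xy≈1 ⟩
    1# * z      ≈⟨ *-identityˡ z ⟩
    z           ∎
    where open import Relation.Binary.Reasoning.Setoid setoid

  inv-anti : ∀ {m n} .{{_ : NonZero m}} → m ℕ.≤ n → inv n ≤ inv m
  inv-anti {m} {zero}  m≤n = inv-nonNeg m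
  inv-anti {m} {suc n} m≤n = begin
    inv (suc n)                         ≈⟨ *-identityʳ _ ⟨
    inv (suc n) * 1#                    ≈⟨ *-congˡ (fromℕ-inv m) ⟨
    inv (suc n) * (fromℕ m * inv m)     ≤⟨ *-monoʳ-≤ _ (inv-nonNeg (suc n))
                                             (*-monoˡ-≤ _ (inv-nonNeg m) (fromℕ-mono m≤n)) ⟩
    inv (suc n) * (fromℕ (suc n) * inv m) ≈⟨ solve 3 (λ x y z → x :* (y :* z) := y :* x :* z) refl _ _ _ ⟩
    fromℕ (suc n) * inv (suc n) * inv m ≈⟨ *-congʳ (fromℕ-inv (suc n)) ⟩
    1# * inv m                          ≈⟨ *-identityˡ _ ⟩
    inv m                               ∎
    where open ≤-Reasoning

  -- Sums

  sum-mono : ∀ {n} {f g : Fin n → Carrier} → (∀ i → f i ≤ g i) → sum f ≤ sum g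
  sum-mono {zero}  f≤g = ≤-refl
  sum-mono {suc n} f≤g = +-mono-≤ (f≤g zero) (sum-mono (f≤g ∘ suc))

  sum-const : ∀ n x → sum {n} (λ _ → x) ≈ fromℕ n * x
  sum-const zero    x = sym (zeroˡ x)
  sum-const (suc n) x = trans (+-congˡ (sum-const n x))
    (solve 2 (λ x n → x :+ n :* x := (con 1 :+ n) :* x) refl x (fromℕ n))

  sum-nonNeg : ∀ {n} {f : Fin n → Carrier} → (∀ i → 0# ≤ f i) → 0# ≤ sum f
  sum-nonNeg {zero}  0≤f = ≤-refl
  sum-nonNeg {suc n} 0≤f = +-nonNeg (0≤f zero) (sum-nonNeg (0≤f ∘ suc))

  -- The arithmetic-geometric mean inequality

  product : ∀ {n} → (Fin n → Carrier) → Carrier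
  product {zero}  f = 1#
  product {suc n} f = f zero * product (f ∘ suc)

  ^-nonNeg : ∀ m {x} → 0# ≤ x → 0# ≤ x ^ m
  ^-nonNeg zero    0≤x = 0≤1
  ^-nonNeg (suc m) 0≤x = *-nonNeg 0≤x (^-nonNeg m 0≤x)

  product-nonNeg : ∀ {n} {f : Fin n → Carrier} → (∀ i → 0# ≤ f i) → 0# ≤ product f
  product-nonNeg {zero}  0≤f = 0≤1
  product-nonNeg {suc n} 0≤f = *-nonNeg (0≤f zero) (product-nonNeg (0≤f ∘ suc))

  ^-≤1 : ∀ m {x} → 0# ≤ x → x ≤ 1# → x ^ m ≤ 1#
  ^-≤1 zero    0≤x x≤1 = ≤-refl
  ^-≤1 (suc m) 0≤x x≤1 = ≤-trans (*-mono-≤ 0≤x 0≤1 x≤1 (^-≤1 m 0≤x x≤1)) (≤-reflexive (*-identityˡ 1#))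

  2xy≤x²+y² : ∀ x y → x * y + x * y ≤ x * x + y * y
  2xy≤x²+y² x y = begin
    x * y + x * y                           ≤⟨ x≤x+y (square-nonNeg (x - y)) ⟩
    x * y + x * y + (x - y) * (x - y)       ≈⟨ expand ⟩
    x * x + y * y                           ∎
    where
    open ≤-Reasoning
    d = x - y
    -- Writing x as d + y avoids subtraction.
    expand : x * y + x * y + d * d ≈ x * x + y * y
    expand = begin-equality
      x * y + x * y + d * d
        ≈⟨ +-congʳ (+-cong (*-congʳ x≈d+y) (*-congʳ x≈d+y)) ⟩
      (d + y) * y + (d + y) * y + d * d
        ≈⟨ solve 2 (λ d y → (d :+ y) :* y :+ (d :+ y) :* y :+ d :* d :=
                            (d :+ y) :* (d :+ y) :+ y :* y) refl d y ⟩
      (d + y) * (d + y) + y * y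
        ≈⟨ +-congʳ (*-cong x≈d+y x≈d+y) ⟨
      x * x + y * y ∎
      where
      x≈d+y : x ≈ d + y
      x≈d+y = sym (x-y+y≈x x y)

  -- The graph of x ↦ x ^ (m + 1) lies above its tangent at y. The step from m to
  -- m + 1 multiplies the inequality by x and adds a multiple of (x - y)² ≥ 0.
  power-tangent : ∀ m {x y} → 0# ≤ x → 0# ≤ y →
                  fromℕ (suc m) * (x * y ^ m) ≤ x ^ suc m + fromℕ m * y ^ suc m
  power-tangent zero {x} {y} 0≤x 0≤y = ≤-reflexive
    (solve 2 (λ x y → (con 1 :+ con 0) :* (x :* con 1) := x :* con 1 :+ con 0 :* (y :* con 1)) refl x y)
  power-tangent (suc m) {x} {y} 0≤x 0≤y = +-cancelʳ-≤ ((1# + k) * (x * x * b) + k * (x * y * b)) (begin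
    (1# + (1# + k)) * (x * (y * b)) + ((1# + k) * (x * x * b) + k * (x * y * b))
      ≈⟨ solve 4 (λ x y b k → (con 1 :+ (con 1 :+ k)) :* (x :* (y :* b)) :+
                   ((con 1 :+ k) :* (x :* x :* b) :+ k :* (x :* y :* b)) :=
                   x :* ((con 1 :+ k) :* (x :* b)) :+ (con 1 :+ k) :* b :* (x :* y :+ x :* y))
               refl x y b k ⟩
    x * ((1# + k) * (x * b)) + (1# + k) * b * (x * y + x * y)
      ≤⟨ +-mono-≤ (*-monoʳ-≤ x 0≤x (power-tangent m 0≤x 0≤y))
                  (*-monoʳ-≤ _ (*-nonNeg (fromℕ-nonNeg (suc m)) (^-nonNeg m 0≤y)) (2xy≤x²+y² x y)) ⟩
    x * (a + k * (y * b)) + (1# + k) * b * (x * x + y * y)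
      ≈⟨ solve 5 (λ x y a b k → x :* (a :+ k :* (y :* b)) :+ (con 1 :+ k) :* b :* (x :* x :+ y :* y) :=
                   x :* a :+ (con 1 :+ k) :* (y :* (y :* b)) :+
                   ((con 1 :+ k) :* (x :* x :* b) :+ k :* (x :* y :* b)))
               refl x y a b k ⟩
    x * a + (1# + k) * (y * (y * b)) + ((1# + k) * (x * x * b) + k * (x * y * b)) ∎)
    where
    open ≤-Reasoning
    k = fromℕ m
    a = x ^ suc m
    b = y ^ m

  -- The last m factors, with mean z, contribute at most z ^ m by induction. The first
  -- one is (m + 1) x - m z, so the tangent inequality finishes the step.
  product≤mean^ : ∀ {m} {y : Fin m → Carrier} {x} → (∀ i → 0# ≤ y i) → 0# ≤ x →
                  sum y ≈ fromℕ m * x → product y ≤ x ^ m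
  product≤mean^ {zero}  0≤y 0≤x eq = ≤-refl
  product≤mean^ {suc m} {y} {x} 0≤y 0≤x eq = +-cancelʳ-≤ (fromℕ m * (z * z ^ m)) (begin
    y zero * product (y ∘ suc) + fromℕ m * (z * z ^ m)
      ≤⟨ +-monoˡ-≤ _ (*-monoʳ-≤ _ (0≤y zero) (product≤mean^ (0≤y ∘ suc) 0≤z (sym m*z))) ⟩
    y zero * z ^ m + fromℕ m * (z * z ^ m)
      ≈⟨ solve 4 (λ y m z b → y :* b :+ m :* (z :* b) := (y :+ m :* z) :* b) refl _ _ _ _ ⟩
    (y zero + fromℕ m * z) * z ^ m
      ≈⟨ *-congʳ (trans (+-congˡ m*z) eq) ⟩
    fromℕ (suc m) * x * z ^ m
      ≈⟨ *-assoc _ x _ ⟩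
    fromℕ (suc m) * (x * z ^ m)
      ≤⟨ power-tangent m 0≤x 0≤z ⟩
    x ^ suc m + fromℕ m * (z * z ^ m) ∎)
    where
    open ≤-Reasoning
    z = inv m * sum (y ∘ suc)
    0≤z : 0# ≤ z
    0≤z = *-nonNeg (inv-nonNeg m) (sum-nonNeg (0≤y ∘ suc))
    mean : ∀ {m} (w : Fin m → Carrier) → fromℕ m * (inv m * sum w) ≈ sum w
    mean {zero}  w = zeroˡ _
    mean {suc m} w = trans (sym (*-assoc _ _ _)) (trans (*-congʳ (fromℕ-inv (suc m))) (*-identityˡ _))
    m*z : fromℕ m * z ≈ sum (y ∘ suc)
    m*z = mean (y ∘ suc)

  -- A mean below 1 would force a product below 1.
  product≈1⇒length≤sum : ∀ {m} {y : Fin m → Carrier} → (∀ i → 0# ≤ y i) → product y ≈ 1# →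
                         fromℕ m ≤ sum y
  product≈1⇒length≤sum {zero}  _ _ = ≤-refl
  product≈1⇒length≤sum {suc m} {y} 0≤y prod≈1 = begin
    fromℕ (suc m)                        ≈⟨ *-identityʳ _ ⟨
    fromℕ (suc m) * 1#                   ≤⟨ *-monoʳ-≤ _ (fromℕ-nonNeg (suc m)) 1≤x ⟩
    fromℕ (suc m) * (inv (suc m) * sum y) ≈⟨ eq ⟨
    sum y                                ∎
    where
    open ≤-Reasoning
    x = inv (suc m) * sum y
    0≤x : 0# ≤ x
    0≤x = *-nonNeg (inv-nonNeg (suc m)) (sum-nonNeg 0≤y)
    eq : sum y ≈ fromℕ (suc m) * x
    eq = sym (trans (sym (*-assoc _ _ _)) (trans (*-congʳ (fromℕ-inv (suc m))) (*-identityˡ _)))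
    1≤x : 1# ≤ x
    1≤x x<1 = ≤-trans (≤-reflexive (sym prod≈1)) (≤-trans (product≤mean^ 0≤y 0≤x eq)
      (≤-trans (*-monoʳ-≤ x 0≤x (^-≤1 m 0≤x (<⇒≤ x<1))) (≤-reflexive (*-identityʳ x)))) x<1

-- Random subsets

module RandomSubsets {c ℓ₁ ℓ₂} (R : ArchimedeanOrderedField c ℓ₁ ℓ₂) where

  open ArchimedeanOrderedField R hiding (zero)
  open OrderedFieldProperties R

  𝟙 : Bool → Carrier
  𝟙 b = if b then 1# else 0#

  𝟙-nonNeg : ∀ b → 0# ≤ 𝟙 b
  𝟙-nonNeg true  = 0≤1
  𝟙-nonNeg false = ≤-refl

  𝟙-≤1 : ∀ b → 𝟙 b ≤ 1#
  𝟙-≤1 true  = ≤-refl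
  𝟙-≤1 false = 0≤1

  sum-𝟙 : ∀ {n} (B : Subset n) → sum (λ i → 𝟙 (lookup B i)) ≈ fromℕ ∣ B ∣
  sum-𝟙 []          = refl
  sum-𝟙 (true ∷ B)  = +-congˡ (sum-𝟙 B)
  sum-𝟙 (false ∷ B) = trans (+-identityˡ _) (sum-𝟙 B)

  insert : ∀ {n} → Fin n → Subset n → Subset n
  insert j S = S [ j ]≔ inside

  lookup-insert : ∀ {n} (j : Fin n) S → lookup (insert j S) j ≡ true
  lookup-insert j S = lookup∘updateAt j S

  insert-monotone : ∀ {n} (j i : Fin n) S → lookup S i ≡ true → lookup (insert j S) i ≡ true
  insert-monotone zero    zero    (_ ∷ S) _  = ≡.refl
  insert-monotone zero    (suc i) (_ ∷ S) eq = eq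
  insert-monotone (suc j) zero    (_ ∷ S) eq = eq
  insert-monotone (suc j) (suc i) (_ ∷ S) eq = insert-monotone j i S eq

  card-insert : ∀ {n} (A : Subset n) j S →
                fromℕ ∣ insert j S ∩ A ∣ ≤ fromℕ ∣ S ∩ A ∣ + 𝟙 (lookup A j)
  card-insert (true  ∷ A) zero (true  ∷ S) = x≤x+y 0≤1
  card-insert (true  ∷ A) zero (false ∷ S) = ≤-reflexive (+-comm 1# _)
  card-insert (false ∷ A) zero (true  ∷ S) = x≤x+y ≤-refl
  card-insert (false ∷ A) zero (false ∷ S) = x≤x+y ≤-refl
  card-insert (true  ∷ A) (suc j) (true ∷ S) =
    ≤-trans (+-monoʳ-≤ 1# (card-insert A j S)) (≤-reflexive (sym (+-assoc 1# _ _)))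
  card-insert (true  ∷ A) (suc j) (false ∷ S) = card-insert A j S
  card-insert (false ∷ A) (suc j) (true  ∷ S) = card-insert A j S
  card-insert (false ∷ A) (suc j) (false ∷ S) = card-insert A j S

  module Bernoulli (p q : Carrier) (0≤p : 0# ≤ p) (0≤q : 0# ≤ q) (p+q≈1 : p + q ≈ 1#) where

    -- S is a random set that contains each element independently with
    -- probability p.
    𝔼 : ∀ {n} → (Subset n → Carrier) → Carrier
    𝔼 {zero}  F = F []
    𝔼 {suc n} F = p * 𝔼 (F ∘ (inside ∷_)) + q * 𝔼 (F ∘ (outside ∷_))

    𝔼-mono : ∀ {n} {F H : Subset n → Carrier} → (∀ S → F S ≤ H S) → 𝔼 F ≤ 𝔼 H
    𝔼-mono {zero}  F≤H = F≤H []
    𝔼-mono {suc n} F≤H = +-mono-≤ (*-monoʳ-≤ p 0≤p (𝔼-mono (F≤H ∘ (inside ∷_))))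
                                  (*-monoʳ-≤ q 0≤q (𝔼-mono (F≤H ∘ (outside ∷_))))

    𝔼-cong : ∀ {n} {F H : Subset n → Carrier} → (∀ S → F S ≈ H S) → 𝔼 F ≈ 𝔼 H
    𝔼-cong F≈H = ≤-antisym (𝔼-mono (≤-reflexive ∘ F≈H)) (𝔼-mono (≤-reflexive ∘ sym ∘ F≈H))

    𝔼-const : ∀ {n} x → 𝔼 {n} (λ _ → x) ≈ x
    𝔼-const {zero}  x = refl
    𝔼-const {suc n} x = trans (+-cong (*-congˡ (𝔼-const {n} x)) (*-congˡ (𝔼-const {n} x)))
      (trans (sym (distribʳ x p q)) (trans (*-congʳ p+q≈1) (*-identityˡ x)))

    𝔼-+ : ∀ {n} (F H : Subset n → Carrier) → 𝔼 (λ S → F S + H S) ≈ 𝔼 F + 𝔼 H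
    𝔼-+ {zero}  F H = refl
    𝔼-+ {suc n} F H = trans (+-cong (*-congˡ (𝔼-+ (F ∘ (inside ∷_)) (H ∘ (inside ∷_))))
                                    (*-congˡ (𝔼-+ (F ∘ (outside ∷_)) (H ∘ (outside ∷_)))))
      (solve 6 (λ p q a b c d → p :* (a :+ b) :+ q :* (c :+ d) :=
                                p :* a :+ q :* c :+ (p :* b :+ q :* d)) refl _ _ _ _ _ _)

    𝔼-* : ∀ {n} x (F : Subset n → Carrier) → 𝔼 (λ S → x * F S) ≈ x * 𝔼 F
    𝔼-* {zero}  x F = refl
    𝔼-* {suc n} x F = trans (+-cong (*-congˡ (𝔼-* x (F ∘ (inside ∷_)))) (*-congˡ (𝔼-* x (F ∘ (outside ∷_)))))
      (solve 5 (λ p q x a b → p :* (x :* a) :+ q :* (x :* b) := x :* (p :* a :+ q :* b)) refl _ _ _ _ _)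

    𝔼-sum : ∀ {n m} (F : Fin m → Subset n → Carrier) →
            𝔼 (λ S → sum λ i → F i S) ≈ sum λ i → 𝔼 (F i)
    𝔼-sum {n} {zero}  F = 𝔼-const {n} 0#
    𝔼-sum {n} {suc m} F = trans (𝔼-+ (F zero) _) (+-congˡ (𝔼-sum (F ∘ suc)))

    -- The membership of j is independent of the rest of S, so that conditioning on it
    -- only changes S at j.
    𝔼-∈ : ∀ {n} (j : Fin n) (F : Subset n → Carrier) →
          𝔼 (λ S → 𝟙 (lookup S j) * F S) ≈ p * 𝔼 (F ∘ insert j)
    𝔼-∈ {suc n} zero F = begin
      p * 𝔼 (λ S → 1# * F (inside ∷ S)) + q * 𝔼 (λ S → 0# * F (outside ∷ S))
        ≈⟨ +-cong (*-congˡ (𝔼-* 1# (F ∘ (inside ∷_)))) (*-congˡ (𝔼-* 0# (F ∘ (outside ∷_)))) ⟩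
      p * (1# * e) + q * (0# * 𝔼 (F ∘ (outside ∷_)))
        ≈⟨ solve 4 (λ p q e f → p :* (con 1 :* e) :+ q :* (con 0 :* f) := p :* (con 1 :* e)) refl _ _ _ _ ⟩
      p * (1# * e)
        ≈⟨ *-congˡ (*-congʳ p+q≈1) ⟨
      p * ((p + q) * e)
        ≈⟨ *-congˡ (distribʳ e p q) ⟩
      p * (p * e + q * e) ∎
      where
      open import Relation.Binary.Reasoning.Setoid setoid
      e = 𝔼 (F ∘ (inside ∷_))
    𝔼-∈ {suc n} (suc j) F = trans (+-cong (*-congˡ (𝔼-∈ j (F ∘ (inside ∷_)))) (*-congˡ (𝔼-∈ j (F ∘ (outside ∷_)))))
      (solve 4 (λ p q a b → p :* (p :* a) :+ q :* (p :* b) := p :* (p :* a :+ q :* b)) refl _ _ _ _)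

    𝔼-card : ∀ {n} (A : Subset n) → 𝔼 (λ S → fromℕ ∣ S ∩ A ∣) ≈ fromℕ ∣ A ∣ * p
    𝔼-card []          = sym (zeroˡ p)
    𝔼-card (false ∷ A) = trans (sym (distribʳ _ p q)) (trans (*-congʳ p+q≈1)
      (trans (*-identityˡ _) (𝔼-card A)))
    𝔼-card {suc n} (true ∷ A) = begin
      p * 𝔼 (λ S → 1# + fromℕ ∣ S ∩ A ∣) + q * e
        ≈⟨ +-congʳ (*-congˡ (trans (𝔼-+ (λ _ → 1#) (λ S → fromℕ ∣ S ∩ A ∣)) (+-congʳ (𝔼-const {n} 1#)))) ⟩
      p * (1# + e) + q * e
        ≈⟨ solve 3 (λ p q e → p :* (con 1 :+ e) :+ q :* e := p :+ (p :+ q) :* e) refl p q e ⟩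
      p + (p + q) * e
        ≈⟨ +-congˡ (trans (*-congʳ p+q≈1) (trans (*-identityˡ e) (𝔼-card A))) ⟩
      p + fromℕ ∣ A ∣ * p
        ≈⟨ solve 2 (λ p a → p :+ a :* p := (con 1 :+ a) :* p) refl p (fromℕ ∣ A ∣) ⟩
      (1# + fromℕ ∣ A ∣) * p ∎
      where
      open import Relation.Binary.Reasoning.Setoid setoid
      e = 𝔼 (λ S → fromℕ ∣ S ∩ A ∣)

-- Uniform distributions on subsets and their conditional oracles

module SubsetOracles {c ℓ₁ ℓ₂} (R : ArchimedeanOrderedField c ℓ₁ ℓ₂) where

  open ArchimedeanOrderedField R hiding (zero)
  open OrderedFieldProperties R
  open RandomSubsets R
  open UniformityTesting R

  ∈⇒0<∣∣ : ∀ {n} {B : Subset n} {j} → j ∈ B → 0 ℕ.< ∣ B ∣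
  ∈⇒0<∣∣ j∈B = ℕₚ.≤-<-trans z≤n (x∈p⇒∣p-x∣<∣p∣ j∈B)

  ∉⇒lookup : ∀ {n} {B : Subset n} {j} → j ∉ B → lookup B j ≡ false
  ∉⇒lookup {B = B} {j} j∉B with lookup B j in eq
  ... | true  = ⊥-elim (j∉B (lookup⇒[]= j B eq))
  ... | false = ≡.refl

  empty⇒∣∣≡0 : ∀ {n} {B : Subset n} → ¬ Nonempty B → ∣ B ∣ ≡ 0
  empty⇒∣∣≡0 {n} empty = ≡.trans (≡.cong ∣_∣ (Empty-unique empty)) (∣⊥∣≡0 n)

  weight : ∀ {n} → Subset n → Fin n → Carrier
  weight B j = 𝟙 (lookup B j) * inv ∣ B ∣

  weight-nonNeg : ∀ {n} (B : Subset n) j → 0# ≤ weight B j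
  weight-nonNeg B j = *-nonNeg (𝟙-nonNeg (lookup B j)) (inv-nonNeg ∣ B ∣)

  uniformOn : ∀ {n} (B : Subset n) → Nonempty B → Distribution n
  uniformOn B ne = record
    { prob    = weight B
    ; nonNeg  = weight-nonNeg B
    ; total≈1 = trans (sym (*-distribʳ-sum (inv ∣ B ∣) (λ j → 𝟙 (lookup B j))))
        (trans (*-congʳ (sum-𝟙 B)) (fromℕ-inv ∣ B ∣ {{nonempty⇒nonZero ne}}))
    }

  -- The oracle for the uniform distribution on S answers uniformly from this set. The
  -- second case is the convention for queries of measure zero.
  answerSet : ∀ {n} → Subset n → Subset n → Subset n
  answerSet S A with nonempty? (S ∩ A)
  ... | yes _ = S ∩ A
  ... | no  _ = A

  answerSet-nonempty : ∀ {n} (S : Subset n) {A} → Nonempty A → Nonempty (answerSet S A)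
  answerSet-nonempty S {A} ne with nonempty? (S ∩ A)
  ... | yes ne′ = ne′
  ... | no  _   = ne

  answerSet-⊤ : ∀ {n} (A : Subset n) → answerSet ⊤ A ≡ A
  answerSet-⊤ A with nonempty? (⊤ ∩ A)
  ... | yes _ = ∩-identityˡ A
  ... | no  _ = ≡.refl

  oracle : ∀ {n} → Subset n → Oracle n
  oracle S (A , ne) = uniformOn (answerSet S A) (answerSet-nonempty S ne)

  measure-uniformOn : ∀ {n} (S : Subset n) (ne : Nonempty S) A →
                      measure (uniformOn S ne) A ≈ fromℕ ∣ S ∩ A ∣ * inv ∣ S ∣
  measure-uniformOn S ne A = trans (sum-cong-≋ pointwise)
    (trans (sym (*-distribʳ-sum (inv ∣ S ∣) (λ i → 𝟙 (lookup (S ∩ A) i)))) (*-congʳ (sum-𝟙 (S ∩ A))))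
    where
    pointwise : ∀ i → (if lookup A i then weight S i else 0#) ≈ 𝟙 (lookup (S ∩ A) i) * inv ∣ S ∣
    pointwise i rewrite lookup-zipWith _∧_ i S A with lookup S i | lookup A i
    ... | true  | true  = refl
    ... | true  | false = sym (zeroˡ _)
    ... | false | true  = refl
    ... | false | false = sym (zeroˡ _)

  oracle-isConditional : ∀ {n} (S : Subset n) (ne : Nonempty S) →
                         IsConditionalOracle (uniformOn S ne) (oracle S)
  oracle-isConditional S neS = record { outside = out ; positive = pos ; null = nul }
    where
    out : ∀ A (ne : Nonempty A) {j} → j ∉ A → weight (answerSet S A) j ≈ 0#
    out A ne {j} j∉A with nonempty? (S ∩ A)
    ... | yes _ rewrite ∉⇒lookup {B = S ∩ A} {j} (j∉A ∘ p∩q⊆q S A) = zeroˡ _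
    ... | no  _ rewrite ∉⇒lookup {B = A} {j} j∉A = zeroˡ _

    pos : ∀ A (ne : Nonempty A) (0<μA : 0# < measure (uniformOn S neS) A) {j} → j ∈ A →
          weight (answerSet S A) j ≈ weight S j / measure (uniformOn S neS) A ⟨ 0<μA ⟩
    pos A ne 0<μA {j} j∈A with nonempty? (S ∩ A)
    ... | no empty = ⊥-elim (<-irrefl (sym (trans (measure-uniformOn S neS A)
            (trans (*-congʳ (reflexive (≡.cong fromℕ (empty⇒∣∣≡0 empty)))) (zeroˡ _)))) 0<μA)
    ... | yes ne∩ rewrite lookup-zipWith _∧_ j S A | []=⇒lookup j∈A =
      trans (*-cong (∧-true (lookup S j)) inverses) (sym (*-assoc _ _ _))
      where
      instance
        nz : NonZero ∣ S ∩ A ∣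
        nz = nonempty⇒nonZero ne∩
      ∧-true : ∀ b → 𝟙 (b ∧ true) ≈ 𝟙 b
      ∧-true true  = refl
      ∧-true false = refl
      inverses : inv ∣ S ∩ A ∣ ≈ inv ∣ S ∣ * (measure (uniformOn S neS) A ⁻¹⟨ 0<μA ⟩)
      inverses = inverse-unique (fromℕ-inv ∣ S ∩ A ∣)
        (trans (sym (*-assoc _ _ _)) (trans (*-congʳ (sym (measure-uniformOn S neS A))) (*-inverseʳ 0<μA)))

    nul : ∀ A (ne : Nonempty A) → measure (uniformOn S neS) A ≈ 0# → ∀ {j} → j ∈ A →
          weight (answerSet S A) j ≈ (1/ ∣ A ∣) {{nonempty⇒nonZero ne}}
    nul A ne μA≈0 {j} j∈A with nonempty? (S ∩ A)
    ... | no _ rewrite []=⇒lookup j∈A =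
      trans (*-identityˡ _) (sym (1/-irrelevant ∣ A ∣ {{nonempty⇒nonZero ne}}))
    ... | yes ne∩ = ⊥-elim (<-irrefl (sym ∣S∩A∣≈0) (0<fromℕ ∣ S ∩ A ∣ {{nonempty⇒nonZero ne∩}}))
      where
      open import Relation.Binary.Reasoning.Setoid setoid
      instance
        nzS : NonZero ∣ S ∣
        nzS = nonempty⇒nonZero neS
      ∣S∩A∣≈0 : fromℕ ∣ S ∩ A ∣ ≈ 0#
      ∣S∩A∣≈0 = begin
        fromℕ ∣ S ∩ A ∣                            ≈⟨ *-identityʳ _ ⟨
        fromℕ ∣ S ∩ A ∣ * 1#                       ≈⟨ *-congˡ (fromℕ-inv ∣ S ∣) ⟨
        fromℕ ∣ S ∩ A ∣ * (fromℕ ∣ S ∣ * inv ∣ S ∣) ≈⟨ solve 3 (λ x y z → x :* (y :* z) := x :* z :* y) refl _ _ _ ⟩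
        fromℕ ∣ S ∩ A ∣ * inv ∣ S ∣ * fromℕ ∣ S ∣   ≈⟨ *-congʳ (trans (sym (measure-uniformOn S neS A)) μA≈0) ⟩
        0# * fromℕ ∣ S ∣                           ≈⟨ zeroˡ _ ⟩
        0#                                         ∎

  uniformOracle : ∀ {n} → Oracle n
  uniformOracle (A , ne) = uniformOn A ne

  uniformOracle-isConditional : ∀ {n} (ne : Nonempty {n} ⊤) →
                                IsConditionalOracle (uniformOn ⊤ ne) uniformOracle
  uniformOracle-isConditional ne⊤ = record
    { outside  = λ A ne {j} j∉A → trans (same A j) (Conditional.outside A ne j∉A)
    ; positive = λ A ne 0<μA {j} j∈A → trans (same A j) (Conditional.positive A ne 0<μA j∈A)
    ; null     = λ A ne μA≈0 {j} j∈A → trans (same A j) (Conditional.null A ne μA≈0 j∈A)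
    }
    where
    module Conditional = IsConditionalOracle (oracle-isConditional ⊤ ne⊤)
    same : ∀ A j → weight A j ≈ weight (answerSet ⊤ A) j
    same A j = reflexive (≡.cong (λ B → weight B j) (≡.sym (answerSet-⊤ A)))

-- Means over the answers of an oracle

module Expectations {c ℓ₁ ℓ₂} (R : ArchimedeanOrderedField c ℓ₁ ℓ₂) where

  open ArchimedeanOrderedField R hiding (zero)
  open OrderedFieldProperties R
  open UniformityTesting R

  average : ∀ {n} → Distribution n → (Fin n → Carrier) → Carrier
  average μ f = sum λ j → prob μ j * f j

  average-mono : ∀ {n} (μ : Distribution n) {f g} → (∀ j → f j ≤ g j) → average μ f ≤ average μ g
  average-mono μ f≤g = sum-mono λ j → *-monoʳ-≤ _ (nonNeg μ j) (f≤g j)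

  average-cong : ∀ {n} (μ : Distribution n) {f g} → (∀ j → f j ≈ g j) → average μ f ≈ average μ g
  average-cong μ f≈g = sum-cong-≋ λ j → *-congˡ (f≈g j)

  average-const : ∀ {n} (μ : Distribution n) x → average μ (λ _ → x) ≈ x
  average-const μ x = trans (sym (*-distribʳ-sum x (prob μ)))
    (trans (*-congʳ (total≈1 μ)) (*-identityˡ x))

  average-+ : ∀ {n} (μ : Distribution n) f g →
              average μ (λ j → f j + g j) ≈ average μ f + average μ g
  average-+ μ f g = trans (sum-cong-≋ λ j → distribˡ _ (f j) (g j)) (∑-distrib-+ (λ j → prob μ j * f j) _)

  average-* : ∀ {n} (μ : Distribution n) x f → average μ (λ j → x * f j) ≈ x * average μ f
  average-* μ x f = trans
    (sum-cong-≋ λ j → solve 3 (λ p x y → p :* (x :* y) := x :* (p :* y)) refl (prob μ j) x (f j))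
    (sym (*-distribˡ-sum x (λ j → prob μ j * f j)))

  average-sum : ∀ {n m} (μ : Distribution n) (F : Fin m → Fin n → Carrier) →
                average μ (λ j → sum λ i → F i j) ≈ sum λ i → average μ (F i)
  average-sum {m = zero}  μ F = average-const μ 0#
  average-sum {m = suc m} μ F = trans (average-+ μ (F zero) _) (+-congˡ (average-sum μ (F ∘ suc)))

  average-nonNeg : ∀ {n} (μ : Distribution n) {f} → (∀ j → 0# ≤ f j) → 0# ≤ average μ f
  average-nonNeg μ 0≤f = sum-nonNeg λ j → *-nonNeg (nonNeg μ j) (0≤f j)

  module _ {n} (O : Oracle n) where

    expectation-mono : ∀ {t} (As : Vec (Query n) t) {f g} → (∀ js → f js ≤ g js) →
                       expectation O As f ≤ expectation O As g
    expectation-mono []       f≤g = f≤g []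
    expectation-mono (A ∷ As) f≤g = average-mono (O A) λ j → expectation-mono As (f≤g ∘ (j ∷_))

    expectation-nonNeg : ∀ {t} (As : Vec (Query n) t) {f} → (∀ js → 0# ≤ f js) →
                         0# ≤ expectation O As f
    expectation-nonNeg []       0≤f = 0≤f []
    expectation-nonNeg (A ∷ As) 0≤f = average-nonNeg (O A) λ j → expectation-nonNeg As (0≤f ∘ (j ∷_))

    expectation-const : ∀ {t} (As : Vec (Query n) t) x → expectation O As (λ _ → x) ≈ x
    expectation-const []       x = refl
    expectation-const (A ∷ As) x =
      trans (average-cong (O A) λ _ → expectation-const As x) (average-const (O A) x)

    expectation-+ : ∀ {t} (As : Vec (Query n) t) f g →
                    expectation O As (λ js → f js + g js) ≈ expectation O As f + expectation O As g
    expectation-+ []       f g = refl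
    expectation-+ (A ∷ As) f g =
      trans (average-cong (O A) λ j → expectation-+ As (f ∘ (j ∷_)) (g ∘ (j ∷_)))
            (average-+ (O A) (λ j → expectation O As (f ∘ (j ∷_))) _)

    expectation-* : ∀ {t} (As : Vec (Query n) t) x f →
                    expectation O As (λ js → x * f js) ≈ x * expectation O As f
    expectation-* []       x f = refl
    expectation-* (A ∷ As) x f =
      trans (average-cong (O A) λ j → expectation-* As x (f ∘ (j ∷_)))
            (average-* (O A) x (λ j → expectation O As (f ∘ (j ∷_))))

    expectation-sum : ∀ {t m} (As : Vec (Query n) t) (F : Fin m → Vec (Fin n) t → Carrier) →
                      expectation O As (λ js → sum λ i → F i js) ≈ sum λ i → expectation O As (F i)
    expectation-sum {m = zero}  As F = expectation-const As 0#
    expectation-sum {m = suc m} As F =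
      trans (expectation-+ As (F zero) _) (+-congˡ (expectation-sum As (F ∘ suc)))

    -- The answers are independent, and the other ones integrate to 1.
    expectation-lookup : ∀ {t} (As : Vec (Query n) t) i (g : Fin n → Carrier) →
                         expectation O As (λ js → g (lookup js i)) ≈ average (O (lookup As i)) g
    expectation-lookup (A ∷ As) zero    g = average-cong (O A) λ j → expectation-const As (g j)
    expectation-lookup (A ∷ As) (suc i) g =
      trans (average-cong (O A) λ _ → expectation-lookup As i g) (average-const (O A) _)

-- Summation over the scales

module Scales {c ℓ₁ ℓ₂} (R : ArchimedeanOrderedField c ℓ₁ ℓ₂) where

  open ArchimedeanOrderedField R hiding (zero)
  open OrderedFieldProperties R

  -- Up to factors that depend on the number of queries, this bounds how well the answer
  -- to a query of size a tells a random set of density 1/M from the full set. The flag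
  -- states whether M ≤ a.
  rate : ℕ → Bool → ℕ → Carrier
  rate M true  a = fromℕ M * inv a
  rate M false a = fromℕ a * inv M

  rate-nonNeg : ∀ M b a → 0# ≤ rate M b a
  rate-nonNeg M true  a = *-nonNeg (fromℕ-nonNeg M) (inv-nonNeg a)
  rate-nonNeg M false a = *-nonNeg (fromℕ-nonNeg a) (inv-nonNeg M)

  2^-nonZero : ∀ k → NonZero (2 ℕ.^ k)
  2^-nonZero k = ℕₚ.m^n≢0 2 k

  rateAt : ℕ → ℕ → Carrier
  rateAt k a = rate (2 ℕ.^ k) (2 ℕ.^ k ℕ.≤ᵇ a) a

  sum-last : ∀ L (f : ℕ → Carrier) → sum {suc L} (f ∘ toℕ) ≈ sum {L} (f ∘ toℕ) + f L
  sum-last zero    f = +-comm (f 0) 0#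
  sum-last (suc L) f = trans (+-congˡ (sum-last L (f ∘ suc))) (sym (+-assoc _ _ _))

  halve : ∀ a k → fromℕ (2 ℕ.* a) * inv (2 ℕ.^ suc k) ≈ fromℕ a * inv (2 ℕ.^ k)
  halve a k = trans (*-congʳ (trans (fromℕ-* 2 a) (*-comm _ _)))
    (trans (*-assoc _ _ _) (*-congˡ (inverse-unique {fromℕ (2 ℕ.^ k)}
      (trans (solve 3 (λ x y z → x :* (y :* z) := y :* x :* z) refl _ _ _)
        (trans (*-congʳ (sym (fromℕ-* 2 (2 ℕ.^ k)))) (fromℕ-inv (2 ℕ.^ suc k) {{2^-nonZero (suc k)}})))
      (fromℕ-inv (2 ℕ.^ k) {{2^-nonZero k}}))))

  inv-ratio-≤1 : ∀ {m n} → m ℕ.≤ n → fromℕ m * inv n ≤ 1#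
  inv-ratio-≤1 {m} {n} m≤n = ≤-trans (*-monoˡ-≤ _ (inv-nonNeg n) (fromℕ-mono m≤n)) (fromℕ-inv-≤1 n)

  module _ (a : ℕ) where

    partialSum : ℕ → Carrier
    partialSum L = sum {L} (λ k → rateAt (toℕ k) a)

    partialSum-suc : ∀ L → partialSum (suc L) ≈ partialSum L + rateAt L a
    partialSum-suc L = sum-last L (λ k → rateAt k a)

    -- As long as 2^k ≤ a the rates double, so their sum is controlled by its last term.
    -- Afterwards they halve; the summand 2a/2^L reserves room for all rates from L on.
    data Progress (L : ℕ) : Set ℓ₂ where
      growing  : 2 ℕ.^ L ℕ.≤ 2 ℕ.* a → partialSum L ≤ fromℕ (2 ℕ.^ L) * inv a → Progress L
      decaying : 2 ℕ.* a ℕ.< 2 ℕ.^ L → partialSum L + fromℕ (2 ℕ.* a) * inv (2 ℕ.^ L) ≤ fromℕ 4 → Progress L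

    growing-≤2 : ∀ L → 2 ℕ.^ L ℕ.≤ 2 ℕ.* a → partialSum L ≤ fromℕ (2 ℕ.^ L) * inv a → partialSum L ≤ fromℕ 2
    growing-≤2 L 2^L≤2a sum≤ = begin
      partialSum L                     ≤⟨ sum≤ ⟩
      fromℕ (2 ℕ.^ L) * inv a          ≤⟨ *-monoˡ-≤ _ (inv-nonNeg a) (fromℕ-mono 2^L≤2a) ⟩
      fromℕ (2 ℕ.* a) * inv a          ≈⟨ trans (*-congʳ (fromℕ-* 2 a)) (*-assoc _ _ _) ⟩
      fromℕ 2 * (fromℕ a * inv a)      ≤⟨ *-monoʳ-≤ _ (fromℕ-nonNeg 2) (fromℕ-inv-≤1 a) ⟩
      fromℕ 2 * 1#                     ≈⟨ *-identityʳ _ ⟩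
      fromℕ 2                          ∎
      where open ≤-Reasoning

    progress : .{{NonZero a}} → ∀ L → Progress L
    progress zero = growing (ℕₚ.≤-trans (ℕ.>-nonZero⁻¹ a) (ℕₚ.m≤m+n a _))
      (*-nonNeg (fromℕ-nonNeg 1) (inv-nonNeg a))
    progress (suc L) with progress L | 2 ℕ.^ L ℕ.≤ᵇ a in eq | partialSum-suc L
    ... | growing _ sum≤ | true | step = growing
      (ℕₚ.*-monoʳ-≤ 2 (ℕₚ.≤ᵇ⇒≤ (2 ℕ.^ L) a (≡.subst IsTrue (≡.sym eq) tt))) (begin
      partialSum (suc L)
        ≈⟨ step ⟩
      partialSum L + fromℕ (2 ℕ.^ L) * inv a
        ≤⟨ +-monoˡ-≤ _ sum≤ ⟩
      fromℕ (2 ℕ.^ L) * inv a + fromℕ (2 ℕ.^ L) * inv a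
        ≈⟨ solve 2 (λ x y → x :* y :+ x :* y := (con 1 :+ (con 1 :+ con 0)) :* x :* y) refl _ _ ⟩
      fromℕ 2 * fromℕ (2 ℕ.^ L) * inv a   ≈⟨ *-congʳ (fromℕ-* 2 (2 ℕ.^ L)) ⟨
      fromℕ (2 ℕ.^ suc L) * inv a         ∎)
      where open ≤-Reasoning
    ... | growing 2^L≤2a sum≤ | false | step = decaying (ℕₚ.*-monoʳ-< 2 a<2^L) (begin
      partialSum (suc L) + fromℕ (2 ℕ.* a) * inv (2 ℕ.^ suc L)
        ≈⟨ +-cong step (halve a L) ⟩
      partialSum L + fromℕ a * inv (2 ℕ.^ L) + fromℕ a * inv (2 ℕ.^ L)
        ≤⟨ +-mono-≤ (+-mono-≤ (growing-≤2 L 2^L≤2a sum≤) small) small ⟩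
      fromℕ 2 + 1# + 1#
        ≈⟨ solve 0 (con 1 :+ (con 1 :+ con 0) :+ con 1 :+ con 1 :=
                    con 1 :+ (con 1 :+ (con 1 :+ (con 1 :+ con 0)))) refl ⟩
      fromℕ 4 ∎)
      where
      open ≤-Reasoning
      a<2^L : a ℕ.< 2 ℕ.^ L
      a<2^L = ℕₚ.≰⇒> λ le → ≡.subst IsTrue eq (ℕₚ.≤⇒≤ᵇ le)
      small : fromℕ a * inv (2 ℕ.^ L) ≤ 1#
      small = inv-ratio-≤1 (ℕₚ.<⇒≤ a<2^L)
    ... | decaying 2a<2^L _ | true | step = ⊥-elim (ℕₚ.<⇒≱ 2a<2^L
      (ℕₚ.≤-trans (ℕₚ.≤ᵇ⇒≤ (2 ℕ.^ L) a (≡.subst IsTrue (≡.sym eq) tt)) (ℕₚ.m≤m+n a _)))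
    ... | decaying 2a<2^L sum≤ | false | step = decaying (ℕₚ.<-≤-trans 2a<2^L (ℕₚ.m≤m+n _ _)) (begin
      partialSum (suc L) + fromℕ (2 ℕ.* a) * inv (2 ℕ.^ suc L)
        ≈⟨ +-cong step (halve a L) ⟩
      partialSum L + fromℕ a * inv (2 ℕ.^ L) + fromℕ a * inv (2 ℕ.^ L)
        ≈⟨ solve 3 (λ s x y → s :+ x :* y :+ x :* y := s :+ (con 1 :+ (con 1 :+ con 0)) :* x :* y) refl _ _ _ ⟩
      partialSum L + fromℕ 2 * fromℕ a * inv (2 ℕ.^ L)
        ≈⟨ +-congˡ (*-congʳ (fromℕ-* 2 a)) ⟨
      partialSum L + fromℕ (2 ℕ.* a) * inv (2 ℕ.^ L)
        ≤⟨ sum≤ ⟩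
      fromℕ 4 ∎)
      where open ≤-Reasoning

    sum-rate-≤4 : .{{NonZero a}} → ∀ L → sum {L} (λ k → rateAt (toℕ k) a) ≤ fromℕ 4
    sum-rate-≤4 L with progress L
    ... | growing 2^L≤2a sum≤ = ≤-trans (growing-≤2 L 2^L≤2a sum≤) (fromℕ-mono {2} {4} (s≤s (s≤s z≤n)))
    ... | decaying _ sum≤     = ≤-trans (x≤x+y (*-nonNeg (fromℕ-nonNeg (2 ℕ.* a)) (inv-nonNeg (2 ℕ.^ L)))) sum≤

-- Planting answers in a random set

module Planting {c ℓ₁ ℓ₂} (R : ArchimedeanOrderedField c ℓ₁ ℓ₂) (M : ℕ) .{{_ : NonZero M}} where

  open ArchimedeanOrderedField R hiding (zero)
  open OrderedFieldProperties R
  open RandomSubsets R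
  open SubsetOracles R
  open Expectations R
  open UniformityTesting R

  p : Carrier
  p = inv M

  M*p≈1 : fromℕ M * p ≈ 1#
  M*p≈1 = fromℕ-inv M

  p≤1 : p ≤ 1#
  p≤1 = ≤-trans (inv-anti (ℕ.>-nonZero⁻¹ M)) (≤-reflexive
    (trans (sym (*-identityˡ _)) (trans (*-congʳ (sym fromℕ-1)) (fromℕ-inv 1))))

  open Bernoulli p (1# - p) (inv-nonNeg M) (x≤y⇒0≤y-x p≤1)
    (trans (+-comm p _) (x-y+y≈x 1# p)) public

  module _ {n : ℕ} where

    -- A random set is expected to meet large queries and to miss the other ones.
    isLarge : Subset n → Bool
    isLarge A = M ℕ.≤ᵇ ∣ A ∣

    plantAnswer : Bool → Fin n → Subset n → Subset n
    plantAnswer true  j S = insert j S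
    plantAnswer false j S = S

    -- Conditioned on the answers of its oracle, the random set contains the answers to
    -- large queries. Other answers reveal nothing about it as long as it misses the
    -- query.
    plant : ∀ {t} → Vec (Query n) t → Vec (Fin n) t → Subset n → Subset n
    plant []             []       S = S
    plant ((A , _) ∷ As) (j ∷ js) S = plant As js (plantAnswer (isLarge A) j S)

    -- The factor setFactor without the indicator of the event that S misses A, hence
    -- always invertible.
    inverseDensity : Bool → Subset n → Subset n → Carrier
    inverseDensity true  A S = fromℕ ∣ A ∣ * p * inv (suc ∣ S ∩ A ∣)
    inverseDensity false A S = 1#

    -- Relative to the uniform answer on a large query A, the oracle of S gives j with
    -- ratio [j ∈ S] |A| / |S ∩ A|. This is split into M [j ∈ S], which has mean 1, and
    -- |A| / (M |S ∩ A|), which is mostly close to 1; the successor keeps the latter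
    -- defined for all S. On the other queries the ratio is at least the indicator that
    -- S misses A.
    setFactor : Bool → Subset n → Subset n → Carrier
    setFactor true  A S = fromℕ ∣ A ∣ * p * inv (suc ∣ S ∩ A ∣)
    setFactor false A S = 𝟙 (not (does (nonempty? (S ∩ A))))

    answerFactor : Bool → Fin n → Subset n → Carrier
    answerFactor true  j S = fromℕ M * 𝟙 (lookup S j)
    answerFactor false j S = 1#

    setFactor-nonNeg : ∀ d A S → 0# ≤ setFactor d A S
    setFactor-nonNeg true  A S = *-nonNeg (*-nonNeg (fromℕ-nonNeg ∣ A ∣) (inv-nonNeg M)) (inv-nonNeg (suc ∣ S ∩ A ∣))
    setFactor-nonNeg false A S = 𝟙-nonNeg _

    answerFactor-nonNeg : ∀ d j S → 0# ≤ answerFactor d j S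
    answerFactor-nonNeg true  j S = *-nonNeg (fromℕ-nonNeg M) (𝟙-nonNeg _)
    answerFactor-nonNeg false j S = 0≤1

    setFactors : ∀ {t} → Vec (Query n) t → Subset n → Carrier
    setFactors As S = product λ i → setFactor (isLarge (proj₁ (lookup As i))) (proj₁ (lookup As i)) S

    setFactors-nonNeg : ∀ {t} (As : Vec (Query n) t) S → 0# ≤ setFactors As S
    setFactors-nonNeg As S = product-nonNeg λ i →
      setFactor-nonNeg (isLarge (proj₁ (lookup As i))) (proj₁ (lookup As i)) S

    oracle-lower-bound : ∀ {A} (ne : Nonempty A) d S j →
                         weight A j * (answerFactor d j S * setFactor d A S) ≤ prob (oracle S (A , ne)) j
    oracle-lower-bound {A} ne true S j = ≤-trans (≤-reflexive simplify) compare
      where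
      instance
        nz : NonZero ∣ A ∣
        nz = nonempty⇒nonZero ne
      𝟙-∧ : ∀ b b′ → 𝟙 b′ * 𝟙 b ≈ 𝟙 (b ∧ b′)
      𝟙-∧ true  b′ = *-identityʳ _
      𝟙-∧ false b′ = zeroʳ _
      simplify : weight A j * (fromℕ M * 𝟙 (lookup S j) * (fromℕ ∣ A ∣ * p * inv (suc ∣ S ∩ A ∣)))
               ≈ 𝟙 (lookup (S ∩ A) j) * inv (suc ∣ S ∩ A ∣)
      simplify = begin
        𝟙 (lookup A j) * inv ∣ A ∣ * (fromℕ M * 𝟙 (lookup S j) * (fromℕ ∣ A ∣ * p * inv (suc ∣ S ∩ A ∣)))
          ≈⟨ solve 7 (λ x a′ m y a p z → x :* a′ :* (m :* y :* (a :* p :* z)) :=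
                                         a :* a′ :* (m :* p) :* (x :* y :* z)) refl _ _ _ _ _ _ _ ⟩
        fromℕ ∣ A ∣ * inv ∣ A ∣ * (fromℕ M * p) * (𝟙 (lookup A j) * 𝟙 (lookup S j) * inv (suc ∣ S ∩ A ∣))
          ≈⟨ *-congʳ (trans (*-cong (fromℕ-inv ∣ A ∣) M*p≈1) (*-identityˡ 1#)) ⟩
        1# * (𝟙 (lookup A j) * 𝟙 (lookup S j) * inv (suc ∣ S ∩ A ∣))
          ≈⟨ trans (*-identityˡ _) (*-congʳ (𝟙-∧ (lookup S j) (lookup A j))) ⟩
        𝟙 (lookup S j ∧ lookup A j) * inv (suc ∣ S ∩ A ∣)
          ≡⟨ ≡.cong (λ b → 𝟙 b * inv (suc ∣ S ∩ A ∣)) (lookup-zipWith _∧_ j S A) ⟨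
        𝟙 (lookup (S ∩ A) j) * inv (suc ∣ S ∩ A ∣) ∎
        where open import Relation.Binary.Reasoning.Setoid setoid
      compare : 𝟙 (lookup (S ∩ A) j) * inv (suc ∣ S ∩ A ∣) ≤ weight (answerSet S A) j
      compare with nonempty? (S ∩ A)
      ... | yes ne∩ = *-monoʳ-≤ _ (𝟙-nonNeg _) (inv-anti {{nonempty⇒nonZero ne∩}} (ℕₚ.n≤1+n _))
      ... | no empty rewrite ∉⇒lookup {B = S ∩ A} {j} (λ j∈ → empty (j , j∈)) =
        ≤-trans (≤-reflexive (zeroˡ _)) (weight-nonNeg A j)
    oracle-lower-bound {A} ne false S j with nonempty? (S ∩ A)
    ... | yes _ = ≤-trans (≤-reflexive (trans (*-congˡ (zeroʳ _)) (zeroʳ _))) (weight-nonNeg (S ∩ A) j)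
    ... | no  _ = ≤-reflexive (trans (*-congˡ (*-identityˡ 1#)) (*-identityʳ _))

    plant-monotone : ∀ {t} (As : Vec (Query n) t) js S j →
                     lookup S j ≡ true → lookup (plant As js S) j ≡ true
    plant-monotone []             []       S i eq = eq
    plant-monotone ((A , _) ∷ As) (j ∷ js) S i eq = plant-monotone As js _ i (step (isLarge A))
      where
      step : ∀ d → lookup (plantAnswer d j S) i ≡ true
      step true  = insert-monotone j i S eq
      step false = eq

    -- The factor M [j ∈ S] has mean 1 and amounts to inserting j. Planting only enlarges
    -- S, so that membership in S may be replaced by membership in the planted set.
    𝔼-plantAnswer : ∀ {t} (As : Vec (Query n) t) js (d : Bool) j {H : Subset n → Carrier} →
               (∀ S → 0# ≤ H S) →
               𝔼 (λ S → H (plant As js (plantAnswer d j S))) ≤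
               𝔼 (λ S → answerFactor d j (plant As js S) * H (plant As js S))
    𝔼-plantAnswer As js false j {H} 0≤H = 𝔼-mono {n} λ S → ≤-reflexive (sym (*-identityˡ _))
    𝔼-plantAnswer As js true j {H} 0≤H = begin
      𝔼 (λ S → H (plant As js (insert j S)))
        ≈⟨ trans (*-congʳ M*p≈1) (*-identityˡ _) ⟨
      fromℕ M * p * 𝔼 (λ S → H (plant As js (insert j S)))
        ≈⟨ *-assoc _ _ _ ⟩
      fromℕ M * (p * 𝔼 (λ S → H (plant As js (insert j S))))
        ≈⟨ *-congˡ (𝔼-∈ j (λ S → H (plant As js S))) ⟨
      fromℕ M * 𝔼 (λ S → 𝟙 (lookup S j) * H (plant As js S))
        ≈⟨ 𝔼-* {n} (fromℕ M) _ ⟨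
      𝔼 (λ S → fromℕ M * (𝟙 (lookup S j) * H (plant As js S)))
        ≤⟨ 𝔼-mono {n} (λ S → *-monoʳ-≤ _ (fromℕ-nonNeg M) (*-monoˡ-≤ _ (0≤H _) (𝟙-plant S))) ⟩
      𝔼 (λ S → fromℕ M * (𝟙 (lookup (plant As js S) j) * H (plant As js S)))
        ≤⟨ 𝔼-mono {n} (λ S → ≤-reflexive (sym (*-assoc _ _ _))) ⟩
      𝔼 (λ S → fromℕ M * 𝟙 (lookup (plant As js S) j) * H (plant As js S)) ∎
      where
      open ≤-Reasoning
      𝟙-plant : ∀ S → 𝟙 (lookup S j) ≤ 𝟙 (lookup (plant As js S) j)
      𝟙-plant S with lookup S j in eq
      ... | false = 𝟙-nonNeg _
      ... | true rewrite plant-monotone As js S j eq = ≤-refl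

    -- By induction on the queries: G collects the factors of the queries answered so far,
    -- and the factor of each answer is exchanged for planting that answer.
    expectation-lower-bound :
      ∀ {t} (As : Vec (Query n) t) {G : Subset n → Carrier} {f : Vec (Fin n) t → Carrier} →
      (∀ S → 0# ≤ G S) → (∀ js → 0# ≤ f js) →
      expectation uniformOracle As (λ js → f js * 𝔼 (λ S → G (plant As js S) * setFactors As (plant As js S)))
      ≤ 𝔼 (λ S → G S * expectation (oracle S) As f)
    expectation-lower-bound [] {G} {f} 0≤G 0≤f = ≤-reflexive (trans (sym (𝔼-* {n} (f []) _))
      (𝔼-cong {n} λ S → solve 2 (λ f g → f :* (g :* con 1) := g :* f) refl (f []) (G S)))
    expectation-lower-bound ((A , ne) ∷ As) {G} {f} 0≤G 0≤f = begin
      average (uniformOn A ne) (λ j → expectation uniformOracle As λ js →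
        f (j ∷ js) * 𝔼 (λ S → H (plant As js (plantAnswer d j S))))
        ≤⟨ average-mono (uniformOn A ne) (λ j → expectation-mono uniformOracle As λ js →
             *-monoʳ-≤ _ (0≤f (j ∷ js)) (≤-trans (𝔼-plantAnswer As js d j 0≤H)
               (≤-reflexive (𝔼-cong {n} λ S → regroup j (plant As js S))))) ⟩
      average (uniformOn A ne) (λ j → expectation uniformOracle As λ js →
        f (j ∷ js) * 𝔼 (λ S → G′ j (plant As js S) * setFactors As (plant As js S)))
        ≤⟨ average-mono (uniformOn A ne) (λ j →
             expectation-lower-bound As (0≤G′ j) (0≤f ∘ (j ∷_))) ⟩
      average (uniformOn A ne) (λ j → 𝔼 (λ S → G′ j S * E j S))
        ≈⟨ sum-cong-≋ (λ j → 𝔼-* {n} (weight A j) (λ S → G′ j S * E j S)) ⟨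
      sum (λ j → 𝔼 (λ S → weight A j * (G′ j S * E j S)))
        ≈⟨ 𝔼-sum {n} (λ j S → weight A j * (G′ j S * E j S)) ⟨
      𝔼 (λ S → sum λ j → weight A j * (G′ j S * E j S))
        ≤⟨ 𝔼-mono {n} (λ S → sum-mono λ j → bound j S) ⟩
      𝔼 (λ S → sum λ j → G S * (prob (oracle S (A , ne)) j * E j S))
        ≈⟨ 𝔼-cong {n} (λ S → sym (*-distribˡ-sum (G S) (λ j → prob (oracle S (A , ne)) j * E j S))) ⟩
      𝔼 (λ S → G S * expectation (oracle S) ((A , ne) ∷ As) f) ∎
      where
      open ≤-Reasoning
      d = isLarge A
      H : Subset n → Carrier
      H S = G S * (setFactor d A S * setFactors As S)
      0≤H : ∀ S → 0# ≤ H S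
      0≤H S = *-nonNeg (0≤G S) (*-nonNeg (setFactor-nonNeg d A S) (setFactors-nonNeg As S))
      G′ : Fin n → Subset n → Carrier
      G′ j S = G S * (answerFactor d j S * setFactor d A S)
      0≤G′ : ∀ j S → 0# ≤ G′ j S
      0≤G′ j S = *-nonNeg (0≤G S) (*-nonNeg (answerFactor-nonNeg d j S) (setFactor-nonNeg d A S))
      E : Fin n → Subset n → Carrier
      E j S = expectation (oracle S) As (f ∘ (j ∷_))
      regroup : ∀ j S → answerFactor d j S * H S ≈ G′ j S * setFactors As S
      regroup j S = solve 4 (λ v g x y → v :* (g :* (x :* y)) := g :* (v :* x) :* y) refl _ _ _ _
      bound : ∀ j S → weight A j * (G′ j S * E j S) ≤ G S * (prob (oracle S (A , ne)) j * E j S)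
      bound j S = begin
        weight A j * (G S * (answerFactor d j S * setFactor d A S) * E j S)
          ≈⟨ solve 4 (λ w g x e → w :* (g :* x :* e) := g :* (w :* x :* e)) refl _ _ _ _ ⟩
        G S * (weight A j * (answerFactor d j S * setFactor d A S) * E j S)
          ≤⟨ *-monoʳ-≤ _ (0≤G S) (*-monoˡ-≤ _ (expectation-nonNeg (oracle S) As (0≤f ∘ (j ∷_)))
               (oracle-lower-bound ne d S j)) ⟩
        G S * (prob (oracle S (A , ne)) j * E j S) ∎

-- Distinguishing a random set from the full set

module ErrorBound {c ℓ₁ ℓ₂} (R : ArchimedeanOrderedField c ℓ₁ ℓ₂) (M : ℕ) .{{_ : NonZero M}} where

  open ArchimedeanOrderedField R hiding (zero)
  open OrderedFieldProperties R
  open RandomSubsets R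
  open SubsetOracles R
  open Expectations R
  open UniformityTesting R
  open Planting R M
  open Scales R

  product-* : ∀ {m} (f g : Fin m → Carrier) → product f * product g ≈ product (λ i → f i * g i)
  product-* {zero}  f g = *-identityˡ 1#
  product-* {suc m} f g = trans
    (solve 4 (λ a b c d → a :* b :* (c :* d) := a :* c :* (b :* d)) refl _ _ _ _)
    (*-congˡ (product-* (f ∘ suc) (g ∘ suc)))

  product-1 : ∀ {m} {f : Fin m → Carrier} → (∀ i → f i ≈ 1#) → product f ≈ 1#
  product-1 {zero}  f≈1 = refl
  product-1 {suc m} f≈1 = trans (*-cong (f≈1 zero) (product-1 (f≈1 ∘ suc))) (*-identityˡ 1#)

  f≤sum : ∀ {m} {f : Fin m → Carrier} → (∀ i → 0# ≤ f i) → ∀ i → f i ≤ sum f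
  f≤sum 0≤f zero    = x≤x+y (sum-nonNeg (0≤f ∘ suc))
  f≤sum 0≤f (suc i) = ≤-trans (f≤sum (0≤f ∘ suc) i) (y≤x+y (0≤f zero))

  module _ {n : ℕ} .{{_ : NonZero n}} where

    -- The number of elements of T in a large query, relative to the mean |A| / M for
    -- random sets. The successor matches the one in setFactor.
    density : Bool → Subset n → Subset n → Carrier
    density true  A T = fromℕ M * inv ∣ A ∣ * fromℕ (suc ∣ T ∩ A ∣)
    density false A T = 1#

    -- A set which meets a query that is not large breaks the comparison; the number of
    -- such elements bounds the indicator of this event.
    collisions : Bool → Subset n → Subset n → Carrier
    collisions true  A T = 0#
    collisions false A T = fromℕ ∣ T ∩ A ∣

    -- The size relative to n/2: it is at least 1 if T is too large to be far from the
    -- full set.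
    relativeSize : Subset n → Carrier
    relativeSize T = fromℕ 2 * inv n * fromℕ ∣ T ∩ ⊤ ∣

    -- The uniform distribution on an admissible set has to be rejected.
    admissible : Subset n → Bool
    admissible T = does (nonempty? T) ∧ (2 ℕ.* ∣ T ∣ ℕ.≤ᵇ n)

    density-nonNeg : ∀ b A T → 0# ≤ density b A T
    density-nonNeg true  A T = *-nonNeg (*-nonNeg (fromℕ-nonNeg M) (inv-nonNeg ∣ A ∣)) (fromℕ-nonNeg (suc ∣ T ∩ A ∣))
    density-nonNeg false A T = 0≤1

    collisions-nonNeg : ∀ b A T → 0# ≤ collisions b A T
    collisions-nonNeg true  A T = ≤-refl
    collisions-nonNeg false A T = fromℕ-nonNeg ∣ T ∩ A ∣

    relativeSize-nonNeg : ∀ T → 0# ≤ relativeSize T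
    relativeSize-nonNeg T = *-nonNeg (*-nonNeg (fromℕ-nonNeg 2) (inv-nonNeg n)) (fromℕ-nonNeg ∣ T ∩ ⊤ ∣)

    inverseDensity-nonNeg : ∀ b (A : Subset n) T → 0# ≤ inverseDensity b A T
    inverseDensity-nonNeg true  A T = setFactor-nonNeg true A T
    inverseDensity-nonNeg false A T = 0≤1

    inverseDensity-*-density : ∀ b {A} → Nonempty A → ∀ T → inverseDensity b A T * density b A T ≈ 1#
    inverseDensity-*-density false     ne T = *-identityˡ 1#
    inverseDensity-*-density true  {A} ne T = begin
      fromℕ ∣ A ∣ * p * inv (suc X) * (fromℕ M * inv ∣ A ∣ * fromℕ (suc X))
        ≈⟨ solve 6 (λ a p x′ m a′ x → a :* p :* x′ :* (m :* a′ :* x) :=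
                                      a :* a′ :* (m :* p) :* (x :* x′)) refl _ _ _ _ _ _ ⟩
      fromℕ ∣ A ∣ * inv ∣ A ∣ * (fromℕ M * p) * (fromℕ (suc X) * inv (suc X))
        ≈⟨ *-cong (*-cong (fromℕ-inv ∣ A ∣ {{nonempty⇒nonZero ne}}) M*p≈1) (fromℕ-inv (suc X)) ⟩
      1# * 1# * 1#
        ≈⟨ trans (*-identityʳ _) (*-identityʳ 1#) ⟩
      1# ∎
      where
      open import Relation.Binary.Reasoning.Setoid setoid
      X = ∣ T ∩ A ∣

    collision-or-agree : ∀ b A T → 1# ≤ collisions b A T ⊎ setFactor b A T ≈ inverseDensity b A T
    collision-or-agree true  A T = inj₂ refl
    collision-or-agree false A T with nonempty? (T ∩ A)
    ... | yes (_ , x∈) = inj₁ (≤-trans (≤-reflexive (sym fromℕ-1)) (fromℕ-mono (∈⇒0<∣∣ x∈)))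
    ... | no  _        = inj₂ refl

    all-agree : ∀ {m} {x f g : Fin m → Carrier} → (∀ i → 0# ≤ x i) →
                (∀ i → 1# ≤ x i ⊎ f i ≈ g i) → 1# ≤ sum x ⊎ product f ≈ product g
    all-agree {zero}  0≤x alt = inj₂ refl
    all-agree {suc m} 0≤x alt with alt zero | all-agree (0≤x ∘ suc) (alt ∘ suc)
    ... | inj₁ 1≤x | _        = inj₁ (≤-trans 1≤x (f≤sum 0≤x zero))
    ... | inj₂ _   | inj₁ 1≤x = inj₁ (≤-trans 1≤x (y≤x+y (0≤x zero)))
    ... | inj₂ f≈g | inj₂ eq  = inj₂ (*-cong f≈g eq)

    large-or-admissible : ∀ {T} → Nonempty T → 1# ≤ relativeSize T ⊎ 𝟙 (admissible T) ≈ 1#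
    large-or-admissible {T} ne with nonempty? T | 2 ℕ.* ∣ T ∣ ℕ.≤ᵇ n in eq
    ... | no empty | _         = ⊥-elim (empty ne)
    ... | yes _    | true      = inj₂ refl
    ... | yes _    | false     = inj₁ (begin
      1#                                ≈⟨ fromℕ-inv n ⟨
      fromℕ n * inv n                   ≤⟨ *-monoˡ-≤ _ (inv-nonNeg n) (fromℕ-mono {n} {2 ℕ.* ∣ T ∣}
                                             (ℕₚ.≰⇒≥ λ le → ≡.subst IsTrue eq (ℕₚ.≤⇒≤ᵇ {2 ℕ.* ∣ T ∣} {n} le))) ⟩
      fromℕ (2 ℕ.* ∣ T ∣) * inv n       ≈⟨ *-congʳ (fromℕ-* 2 ∣ T ∣) ⟩
      fromℕ 2 * fromℕ ∣ T ∣ * inv n     ≈⟨ solve 3 (λ x y z → x :* y :* z := x :* z :* y) refl _ _ _ ⟩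
      fromℕ 2 * inv n * fromℕ ∣ T ∣     ≡⟨ ≡.cong (λ B → fromℕ 2 * inv n * fromℕ ∣ B ∣) (∩-identityʳ T) ⟨
      relativeSize T                    ∎)
      where open ≤-Reasoning

    module _ {t} (As : Vec (Query n) t) where

      query : Fin t → Subset n
      query i = proj₁ (lookup As i)

      large : Fin t → Bool
      large i = isLarge (query i)

      N : Carrier
      N = fromℕ (suc t)

      0≤N : 0# ≤ N
      0≤N = fromℕ-nonNeg (suc t)

      -- If T is inadmissible or collides with a query, then the last summand alone is at
      -- least N. Otherwise the product of the factors is the inverse of the product of the
      -- densities, and the means inequality applies to these t + 1 numbers.
      likelihood-lower-bound : ∀ {T} → Nonempty T →
        N ≤ 𝟙 (admissible T) * setFactors As T + sum (λ i → density (large i) (query i) T)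
            + N * (relativeSize T + sum (λ i → collisions (large i) (query i) T))
      likelihood-lower-bound {T} ne =
        cases (large-or-admissible ne)
              (all-agree (λ i → collisions-nonNeg (large i) (query i) T)
                         (λ i → collision-or-agree (large i) (query i) T))
        where
        open ≤-Reasoning
        G Y Z X : Carrier
        G = 𝟙 (admissible T)
        Y = sum (λ i → density (large i) (query i) T)
        Z = relativeSize T
        X = sum (λ i → collisions (large i) (query i) T)
        Φ : Carrier
        Φ = product (λ i → inverseDensity (large i) (query i) T)
        0≤Y : 0# ≤ Y
        0≤Y = sum-nonNeg λ i → density-nonNeg (large i) (query i) T
        0≤X : 0# ≤ X
        0≤X = sum-nonNeg λ i → collisions-nonNeg (large i) (query i) T
        0≤GΨ : 0# ≤ G * setFactors As T
        0≤GΨ = *-nonNeg (𝟙-nonNeg _) (setFactors-nonNeg As T)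
        factors : Fin (suc t) → Carrier
        factors zero    = Φ
        factors (suc i) = density (large i) (query i) T
        penalty : 1# ≤ Z + X → N ≤ G * setFactors As T + Y + N * (Z + X)
        penalty 1≤ = begin
          N                                ≈⟨ *-identityʳ N ⟨
          N * 1#                           ≤⟨ *-monoʳ-≤ N 0≤N 1≤ ⟩
          N * (Z + X)                      ≤⟨ y≤x+y (+-nonNeg 0≤GΨ 0≤Y) ⟩
          G * setFactors As T + Y + N * (Z + X)     ∎
        cases : 1# ≤ Z ⊎ G ≈ 1# → 1# ≤ X ⊎ setFactors As T ≈ Φ → N ≤ G * setFactors As T + Y + N * (Z + X)
        cases (inj₁ 1≤Z) _          = penalty (≤-trans 1≤Z (x≤x+y 0≤X))
        cases (inj₂ _)   (inj₁ 1≤X) = penalty (≤-trans 1≤X (y≤x+y (relativeSize-nonNeg T)))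
        cases (inj₂ G≈1) (inj₂ Ψ≈Φ) = begin
          N
            ≤⟨ product≈1⇒length≤sum {y = factors} nonneg
                 (trans (product-* (λ i → inverseDensity (large i) (query i) T) _)
                   (product-1 λ i → inverseDensity-*-density (large i) (proj₂ (lookup As i)) T)) ⟩
          Φ + Y                            ≈⟨ +-congʳ (trans (*-cong G≈1 Ψ≈Φ) (*-identityˡ Φ)) ⟨
          G * setFactors As T + Y                   ≤⟨ x≤x+y (*-nonNeg 0≤N (+-nonNeg (relativeSize-nonNeg T) 0≤X)) ⟩
          G * setFactors As T + Y + N * (Z + X)     ∎
          where
          nonneg : ∀ i → 0# ≤ factors i
          nonneg zero    = product-nonNeg λ i → inverseDensity-nonNeg (large i) (query i) T
          nonneg (suc i) = density-nonNeg (large i) (query i) T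

    hit : Bool → Fin n → Subset n → Carrier
    hit true  j A = 𝟙 (lookup A j)
    hit false j A = 0#

    hit-≤1 : ∀ b j A → hit b j A ≤ 1#
    hit-≤1 true  j A = 𝟙-≤1 (lookup A j)
    hit-≤1 false j A = 0≤1

    hits : ∀ {t} → Vec (Query n) t → Vec (Fin n) t → Subset n → Carrier
    hits As js A = sum λ i → hit (large As i) (lookup js i) A

    card-plantAnswer : ∀ b j S A → fromℕ ∣ plantAnswer b j S ∩ A ∣ ≤ fromℕ ∣ S ∩ A ∣ + hit b j A
    card-plantAnswer true  j S A = card-insert A j S
    card-plantAnswer false j S A = x≤x+y ≤-refl

    card-plant : ∀ {t} (As : Vec (Query n) t) js S A →
                 fromℕ ∣ plant As js S ∩ A ∣ ≤ fromℕ ∣ S ∩ A ∣ + hits As js A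
    card-plant []             []       S A = x≤x+y ≤-refl
    card-plant ((B , _) ∷ As) (j ∷ js) S A = ≤-trans (card-plant As js _ A)
      (≤-trans (+-monoˡ-≤ _ (card-plantAnswer (isLarge B) j S A)) (≤-reflexive (+-assoc _ _ _)))

    𝔼-card-plant : ∀ {t} (As : Vec (Query n) t) js A →
                   𝔼 (λ S → fromℕ ∣ plant As js S ∩ A ∣) ≤ fromℕ ∣ A ∣ * p + hits As js A
    𝔼-card-plant As js A = begin
      𝔼 (λ S → fromℕ ∣ plant As js S ∩ A ∣)              ≤⟨ 𝔼-mono {n} (λ S → card-plant As js S A) ⟩
      𝔼 (λ S → fromℕ ∣ S ∩ A ∣ + hits As js A)           ≈⟨ 𝔼-+ {n} _ _ ⟩
      𝔼 (λ S → fromℕ ∣ S ∩ A ∣) + 𝔼 {n} (λ _ → hits As js A) ≈⟨ +-cong (𝔼-card A) (𝔼-const {n} _) ⟩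
      fromℕ ∣ A ∣ * p + hits As js A                      ∎
      where open ≤-Reasoning

    hits-≤ : ∀ {t} (As : Vec (Query n) t) js A → hits As js A ≤ fromℕ t
    hits-≤ {t} As js A = ≤-trans (sum-mono λ i → hit-≤1 (large As i) (lookup js i) A)
      (≤-reflexive (trans (sum-const t 1#) (*-identityʳ _)))

    𝔼-density : ∀ {t} (As : Vec (Query n) t) js b {A} → Nonempty A →
                𝔼 (λ S → density b A (plant As js S)) ≤ 1# + fromℕ (suc t) * rate M b ∣ A ∣
    𝔼-density {t} As js false {A} ne = ≤-trans (≤-reflexive (𝔼-const {n} 1#))
      (x≤x+y (*-nonNeg (fromℕ-nonNeg (suc t)) (rate-nonNeg M false ∣ A ∣)))
    𝔼-density {t} As js true {A} ne = begin
      𝔼 (λ S → m * a′ * (1# + fromℕ ∣ plant As js S ∩ A ∣))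
        ≈⟨ trans (𝔼-* {n} (m * a′) _) (*-congˡ (trans (𝔼-+ {n} _ _) (+-congʳ (𝔼-const {n} 1#)))) ⟩
      m * a′ * (1# + 𝔼 (λ S → fromℕ ∣ plant As js S ∩ A ∣))
        ≤⟨ *-monoʳ-≤ _ (rate-nonNeg M true ∣ A ∣) (+-monoʳ-≤ 1#
             (≤-trans (𝔼-card-plant As js A) (+-monoʳ-≤ _ (hits-≤ As js A)))) ⟩
      m * a′ * (1# + (a * p + fromℕ t))
        ≈⟨ solve 5 (λ m a a′ p s → m :* a′ :* (con 1 :+ (a :* p :+ s)) :=
                      a :* a′ :* (m :* p) :+ (con 1 :+ s) :* (m :* a′)) refl m a a′ p (fromℕ t) ⟩
      a * a′ * (m * p) + fromℕ (suc t) * (m * a′)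
        ≈⟨ +-congʳ (trans (*-cong (fromℕ-inv ∣ A ∣ {{nonempty⇒nonZero ne}}) M*p≈1) (*-identityˡ 1#)) ⟩
      1# + fromℕ (suc t) * (m * a′) ∎
      where
      open ≤-Reasoning
      m = fromℕ M
      a = fromℕ ∣ A ∣
      a′ = inv ∣ A ∣

    -- The mean number of elements that S itself has in A, plus those planted there.
    collisionBound : ∀ {t} → Vec (Query n) t → Vec (Fin n) t → Bool → Subset n → Carrier
    collisionBound As js true  A = 0#
    collisionBound As js false A = fromℕ ∣ A ∣ * p + hits As js A

    𝔼-collisions : ∀ {t} (As : Vec (Query n) t) js b A →
                   𝔼 (λ S → collisions b A (plant As js S)) ≤ collisionBound As js b A
    𝔼-collisions As js true  A = ≤-reflexive (𝔼-const {n} 0#)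
    𝔼-collisions As js false A = 𝔼-card-plant As js A

    sizeBound : ℕ → Carrier
    sizeBound t = fromℕ 2 * p + fromℕ 2 * (fromℕ t * inv n)

    𝔼-relativeSize : ∀ {t} (As : Vec (Query n) t) js →
                     𝔼 (λ S → relativeSize (plant As js S)) ≤ sizeBound t
    𝔼-relativeSize {t} As js = begin
      𝔼 (λ S → fromℕ 2 * inv n * fromℕ ∣ plant As js S ∩ ⊤ ∣)
        ≈⟨ 𝔼-* {n} _ _ ⟩
      fromℕ 2 * inv n * 𝔼 (λ S → fromℕ ∣ plant As js S ∩ ⊤ ∣)
        ≤⟨ *-monoʳ-≤ _ (*-nonNeg (fromℕ-nonNeg 2) (inv-nonNeg n))
             (≤-trans (𝔼-card-plant As js ⊤) (+-monoʳ-≤ _ (hits-≤ As js ⊤))) ⟩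
      fromℕ 2 * inv n * (fromℕ ∣ ⊤ {n} ∣ * p + fromℕ t)
        ≈⟨ *-congˡ (+-congʳ (*-congʳ (reflexive (≡.cong fromℕ (∣⊤∣≡n n))))) ⟩
      fromℕ 2 * inv n * (fromℕ n * p + fromℕ t)
        ≈⟨ solve 5 (λ k x y p s → k :* x :* (y :* p :+ s) := k :* (y :* x :* p) :+ k :* (s :* x)) refl _ _ _ _ _ ⟩
      fromℕ 2 * (fromℕ n * inv n * p) + fromℕ 2 * (fromℕ t * inv n)
        ≈⟨ +-congʳ (*-congˡ (trans (*-congʳ (fromℕ-inv n)) (*-identityˡ p))) ⟩
      sizeBound t ∎
      where open ≤-Reasoning

    module _ {t} (As : Vec (Query n) t) where

      private
        b : Fin t → Bool
        b = large As
        A : Fin t → Subset n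
        A = query As

      totalRate : Carrier
      totalRate = sum λ i → rate M (b i) ∣ A i ∣

      error : Vec (Fin n) t → Carrier
      error js = N As * (totalRate + (sizeBound t + sum (λ i → collisionBound As js (b i) (A i))))

      -- The mean of each density is 1 up to an error, so that the t densities use up all of
      -- N = t + 1 except for 1.
      𝔼-likelihood : ∀ js → (∀ S → Nonempty (plant As js S)) →
        1# ≤ 𝔼 (λ S → 𝟙 (admissible (plant As js S)) * setFactors As (plant As js S)) + error js
      𝔼-likelihood js ne = +-cancelʳ-≤ (fromℕ t) (begin
        1# + fromℕ t
          ≈⟨ 𝔼-const {n} (N As) ⟨
        𝔼 {n} (λ _ → N As)
          ≤⟨ 𝔼-mono {n} (λ S → likelihood-lower-bound As (ne S)) ⟩
        𝔼 (λ S → GΨ (T S) + Y (T S) + N As * (Z (T S) + X (T S)))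
          ≈⟨ trans (𝔼-+ {n} _ _) (+-cong
               (trans (𝔼-+ {n} _ _) (+-congˡ (𝔼-sum {n} λ i S → density (b i) (A i) (T S))))
               (trans (𝔼-* {n} _ _) (*-congˡ (trans (𝔼-+ {n} _ _)
                 (+-congˡ (𝔼-sum {n} λ i S → collisions (b i) (A i) (T S))))))) ⟩
        𝔼 (GΨ ∘ T) + sum (λ i → 𝔼 (λ S → density (b i) (A i) (T S)))
          + N As * (𝔼 (Z ∘ T) + sum (λ i → 𝔼 (λ S → collisions (b i) (A i) (T S))))
          ≤⟨ +-mono-≤
               (+-monoʳ-≤ _ (≤-trans (sum-mono λ i → 𝔼-density As js (b i) (proj₂ (lookup As i)))
                 (≤-reflexive total)))
               (*-monoʳ-≤ _ (0≤N As) (+-mono-≤ (𝔼-relativeSize As js)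
                 (sum-mono λ i → 𝔼-collisions As js (b i) (A i)))) ⟩
        𝔼 (GΨ ∘ T) + (fromℕ t + N As * totalRate) + N As * rest
          ≈⟨ solve 5 (λ g s n r x → g :+ (s :+ n :* r) :+ n :* x := g :+ n :* (r :+ x) :+ s) refl _ _ _ _ _ ⟩
        𝔼 (GΨ ∘ T) + error js + fromℕ t ∎)
        where
        open ≤-Reasoning
        T : Subset n → Subset n
        T = plant As js
        GΨ Y Z X : Subset n → Carrier
        GΨ S = 𝟙 (admissible S) * setFactors As S
        Y S = sum λ i → density (b i) (A i) S
        Z = relativeSize
        X S = sum λ i → collisions (b i) (A i) S
        rest : Carrier
        rest = sizeBound t + sum (λ i → collisionBound As js (b i) (A i))
        total : sum (λ i → 1# + N As * rate M (b i) ∣ A i ∣) ≈ fromℕ t + N As * totalRate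
        total = trans (∑-distrib-+ {t} (λ _ → 1#) _) (+-cong
          (trans (sum-const t 1#) (*-identityʳ _)) (sym (*-distribˡ-sum (N As) (λ i → rate M (b i) ∣ A i ∣))))

      -- The answer to a large query is spread evenly over at least M elements.
      average-hit : ∀ i B → average (uniformOracle (lookup As i)) (λ j → hit (b i) j B) ≤ fromℕ ∣ B ∣ * p
      average-hit i B with b i in eq
      ... | false = ≤-trans (≤-reflexive (average-const (uniformOracle (lookup As i)) 0#))
                        (rate-nonNeg M false ∣ B ∣)
      ... | true  = begin
        sum (λ j → weight (A i) j * 𝟙 (lookup B j))
          ≤⟨ sum-mono (λ j → *-monoˡ-≤ _ (𝟙-nonNeg _) (weight≤p j)) ⟩
        sum (λ j → p * 𝟙 (lookup B j))
          ≈⟨ *-distribˡ-sum p (λ j → 𝟙 (lookup B j)) ⟨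
        p * sum (λ j → 𝟙 (lookup B j))
          ≈⟨ trans (*-congˡ (sum-𝟙 B)) (*-comm p _) ⟩
        fromℕ ∣ B ∣ * p ∎
        where
        open ≤-Reasoning
        weight≤p : ∀ j → weight (A i) j ≤ p
        weight≤p j = ≤-trans
          (*-mono-≤ (𝟙-nonNeg _) (inv-nonNeg M) (𝟙-≤1 (lookup (A i) j))
            (inv-anti (ℕₚ.≤ᵇ⇒≤ M ∣ A i ∣ (≡.subst IsTrue (≡.sym eq) tt))))
          (≤-reflexive (*-identityˡ p))

      expectation-collisionBound : ∀ i →
        expectation uniformOracle As (λ js → collisionBound As js (b i) (A i)) ≤ N As * rate M (b i) ∣ A i ∣
      expectation-collisionBound i with b i
      ... | true  = ≤-trans (≤-reflexive (expectation-const uniformOracle As 0#))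
                      (*-nonNeg (0≤N As) (rate-nonNeg M true ∣ A i ∣))
      ... | false = begin
        expectation uniformOracle As (λ js → a * p + hits As js (A i))
          ≈⟨ trans (expectation-+ uniformOracle As _ _) (+-cong
               (expectation-const uniformOracle As _)
               (expectation-sum uniformOracle As λ k js → hit (b k) (lookup js k) (A i))) ⟩
        a * p + sum (λ k → expectation uniformOracle As (λ js → hit (b k) (lookup js k) (A i)))
          ≤⟨ +-monoʳ-≤ _ (sum-mono λ k → ≤-trans
               (≤-reflexive (expectation-lookup uniformOracle As k λ j → hit (b k) j (A i)))
               (average-hit k (A i))) ⟩
        a * p + sum {t} (λ k → a * p)
          ≈⟨ trans (+-congˡ (sum-const t (a * p)))
               (solve 2 (λ x s → x :+ s :* x := (con 1 :+ s) :* x) refl (a * p) (fromℕ t)) ⟩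
        N As * (a * p) ∎
        where
        open ≤-Reasoning
        a = fromℕ ∣ A i ∣

      totalError : Carrier
      totalError = N As * (totalRate + (sizeBound t + N As * totalRate))

      expectation-error : expectation uniformOracle As error ≤ totalError
      expectation-error = begin
        expectation uniformOracle As error
          ≈⟨ trans (expectation-* uniformOracle As (N As) _) (*-congˡ
               (trans (expectation-+ uniformOracle As _ _) (+-cong (expectation-const uniformOracle As _)
               (trans (expectation-+ uniformOracle As _ _) (+-cong (expectation-const uniformOracle As _)
                 (expectation-sum uniformOracle As λ i js → collisionBound As js (b i) (A i))))))) ⟩
        N As * (totalRate + (sizeBound t
          + sum (λ i → expectation uniformOracle As (λ js → collisionBound As js (b i) (A i)))))
          ≤⟨ *-monoʳ-≤ _ (0≤N As) (+-monoʳ-≤ _ (+-monoʳ-≤ _ (sum-mono expectation-collisionBound))) ⟩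
        N As * (totalRate + (sizeBound t + sum (λ i → N As * rate M (b i) ∣ A i ∣)))
          ≈⟨ *-congˡ (+-congˡ (+-congˡ (*-distribˡ-sum (N As) (λ i → rate M (b i) ∣ A i ∣)))) ⟨
        totalError ∎
        where open ≤-Reasoning

      -- For every vector of answers the mean likelihood ratio is at least 1 minus the
      -- error, and f ≤ 1 keeps the error from being amplified.
      indistinguishable :
        (∀ js S → Nonempty (plant As js S)) → (f : Vec (Fin n) t → Carrier) →
        (∀ js → 0# ≤ f js) → (∀ js → f js ≤ 1#) →
        expectation uniformOracle As f
          ≤ 𝔼 (λ S → 𝟙 (admissible S) * expectation (oracle S) As f) + totalError
      indistinguishable ne f 0≤f f≤1 = begin
        expectation uniformOracle As f
          ≤⟨ expectation-mono uniformOracle As pointwise ⟩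
        expectation uniformOracle As (λ js → f js * L js + error js)
          ≈⟨ expectation-+ uniformOracle As _ _ ⟩
        expectation uniformOracle As (λ js → f js * L js) + expectation uniformOracle As error
          ≤⟨ +-mono-≤ (expectation-lower-bound As (λ S → 𝟙-nonNeg (admissible S)) 0≤f) expectation-error ⟩
        𝔼 (λ S → 𝟙 (admissible S) * expectation (oracle S) As f) + totalError ∎
        where
        open ≤-Reasoning
        L : Vec (Fin n) t → Carrier
        L js = 𝔼 (λ S → 𝟙 (admissible (plant As js S)) * setFactors As (plant As js S))
        0≤error : ∀ js → 0# ≤ error js
        0≤error js = *-nonNeg (0≤N As) (+-nonNeg (sum-nonNeg λ i → rate-nonNeg M (b i) ∣ A i ∣)
          (+-nonNeg (+-nonNeg (*-nonNeg (fromℕ-nonNeg 2) (inv-nonNeg M))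
            (*-nonNeg (fromℕ-nonNeg 2) (*-nonNeg (fromℕ-nonNeg t) (inv-nonNeg n))))
            (sum-nonNeg λ i → 0≤bound (b i) (A i))))
          where
          0≤bound : ∀ b B → 0# ≤ collisionBound As js b B
          0≤bound true  B = ≤-refl
          0≤bound false B = +-nonNeg (rate-nonNeg M false ∣ B ∣) (sum-nonNeg λ i → 0≤hit (b i) (lookup js i))
            where
            0≤hit : ∀ b j → 0# ≤ hit b j B
            0≤hit true  j = 𝟙-nonNeg _
            0≤hit false j = ≤-refl
        pointwise : ∀ js → f js ≤ f js * L js + error js
        pointwise js = begin
          f js                               ≈⟨ *-identityʳ _ ⟨
          f js * 1#                          ≤⟨ *-monoʳ-≤ _ (0≤f js) (𝔼-likelihood js (ne js)) ⟩
          f js * (L js + error js)           ≈⟨ distribˡ _ _ _ ⟩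
          f js * L js + f js * error js      ≤⟨ +-monoʳ-≤ _ (*-monoˡ-≤ _ (0≤error js) (f≤1 js)) ⟩
          f js * L js + 1# * error js        ≈⟨ +-congˡ (*-identityˡ _) ⟩
          f js * L js + error js             ∎

-- Arithmetic of the bound

-- The error at t queries and the additional full set, summed over all scales: each sum
-- of rates of a single query is replaced by its bound 4. The terms 1/M and 1/n of
-- sizeBound are bounded by the rates of queries of sizes 1 and n.
rateTotal sizeTotal errorTotal : ℕ → ℕ
rateTotal t  = suc t ℕ.* 4
sizeTotal t  = 2 ℕ.* 4 ℕ.+ 2 ℕ.* (suc t ℕ.* 4)
errorTotal t = suc (suc t) ℕ.* (rateTotal t ℕ.+ (sizeTotal t ℕ.+ suc (suc t) ℕ.* rateTotal t))

n<2^n : ∀ n → n ℕ.< 2 ℕ.^ n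
n<2^n zero    = s≤s z≤n
n<2^n (suc n) = ℕₚ.+-mono-≤ (ℕₚ.≤-trans (s≤s z≤n) (n<2^n n))
  (ℕₚ.≤-trans (n<2^n n) (ℕₚ.m≤m+n _ 0))

-- With x = t + 2 the total is x (4x² + 8x - 4), which falls short of 8x³ by 4x (x - 1)².
errorTotal-≤ : ∀ t → errorTotal t ℕ.≤ 8 ℕ.* suc (suc t) ℕ.^ 3
errorTotal-≤ t = ℕₚ.m+n≤o⇒m≤o _ (ℕₚ.≤-reflexive (identity t))
  where
  identity : ∀ t → suc (suc t) ℕ.* (suc t ℕ.* 4 ℕ.+ (2 ℕ.* 4 ℕ.+ 2 ℕ.* (suc t ℕ.* 4) ℕ.+ suc (suc t) ℕ.* (suc t ℕ.* 4)))
                     ℕ.+ suc (suc t) ℕ.* (4 ℕ.* (suc t ℕ.* suc t))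
                   ≡ 8 ℕ.* (suc (suc t) ℕ.* (suc (suc t) ℕ.* (suc (suc t) ℕ.* 1)))
  identity = solve-∀

errorTotal-≤2^ : ∀ t → suc (errorTotal t ℕ.* 3) ℕ.≤ 2 ℕ.^ (8 ℕ.+ 3 ℕ.* t)
errorTotal-≤2^ t = begin
  1 ℕ.+ errorTotal t ℕ.* 3
    ≤⟨ ℕₚ.+-mono-≤ (ℕₚ.m^n>0 (suc (suc t)) 3) (ℕₚ.*-monoˡ-≤ 3 (errorTotal-≤ t)) ⟩
  x ℕ.+ 8 ℕ.* x ℕ.* 3
    ≡⟨ collect x ⟩
  25 ℕ.* x
    ≤⟨ ℕₚ.*-mono-≤ (ℕₚ.m≤m+n 25 7) (ℕₚ.^-monoˡ-≤ 3 (n<2^n (suc t))) ⟩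
  2 ℕ.^ 5 ℕ.* (2 ℕ.^ suc t) ℕ.^ 3
    ≡⟨ ≡.cong (2 ℕ.^ 5 ℕ.*_) (ℕₚ.^-*-assoc 2 (suc t) 3) ⟩
  2 ℕ.^ 5 ℕ.* 2 ℕ.^ (suc t ℕ.* 3)
    ≡⟨ ℕₚ.^-distribˡ-+-* 2 5 (suc t ℕ.* 3) ⟨
  2 ℕ.^ (5 ℕ.+ suc t ℕ.* 3)
    ≡⟨ ≡.cong (λ e → 2 ℕ.^ (8 ℕ.+ e)) (ℕₚ.*-comm t 3) ⟩
  2 ℕ.^ (8 ℕ.+ 3 ℕ.* t) ∎
  where
  open ℕₚ.≤-Reasoning
  x : ℕ
  x = suc (suc t) ℕ.^ 3
  collect : ∀ x → x ℕ.+ 8 ℕ.* x ℕ.* 3 ≡ 25 ℕ.* x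
  collect = solve-∀

⌈log₂⌉-≤ : ∀ {m k} → m ℕ.≤ 2 ℕ.^ k → ⌈log₂ m ⌉ ℕ.≤ k
⌈log₂⌉-≤ {k = k} m≤2^k = ℕₚ.≤-trans (⌈log₂⌉-mono-≤ m≤2^k) (ℕₚ.≤-reflexive (⌈log₂2^n⌉≡n k))

threshold : ℕ → ℕ
threshold k = 2 ℕ.^ (2 ℕ.^ k)

k≤loglog : ∀ k {n} → threshold k ℕ.≤ n → k ℕ.≤ ⌈log₂ ⌈log₂ n ⌉ ⌉
k≤loglog k {n} le = begin
  k                                 ≡⟨ ⌈log₂2^n⌉≡n k ⟨
  ⌈log₂ 2 ℕ.^ k ⌉                   ≡⟨ ≡.cong ⌈log₂_⌉ (⌈log₂2^n⌉≡n (2 ℕ.^ k)) ⟨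
  ⌈log₂ ⌈log₂ threshold k ⌉ ⌉       ≤⟨ ⌈log₂⌉-mono-≤ (⌈log₂⌉-mono-≤ le) ⟩
  ⌈log₂ ⌈log₂ n ⌉ ⌉                 ∎
  where open ℕₚ.≤-Reasoning

-- The lower bound 9 excludes t = 0.
≤8+3t⇒≤11t : ∀ {ℓ} t → 9 ℕ.≤ ℓ → ℓ ℕ.≤ 8 ℕ.+ 3 ℕ.* t → ℓ ℕ.≤ 11 ℕ.* t
≤8+3t⇒≤11t zero    9≤ℓ ℓ≤8 with () ← ℕₚ.≤⇒≯ ℓ≤8 9≤ℓ
≤8+3t⇒≤11t {ℓ} (suc t) 9≤ℓ ℓ≤ = begin
  ℓ                                  ≤⟨ ℓ≤ ⟩
  8 ℕ.+ 3 ℕ.* suc t                  ≤⟨ ℕₚ.+-monoˡ-≤ (3 ℕ.* suc t) (ℕₚ.m≤m*n 8 (suc t)) ⟩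
  8 ℕ.* suc t ℕ.+ 3 ℕ.* suc t        ≡⟨ ℕₚ.*-distribʳ-+ (suc t) 8 3 ⟨
  11 ℕ.* suc t                       ∎
  where open ℕₚ.≤-Reasoning

-- Testers at a single scale and at all scales

module Testers {c ℓ₁ ℓ₂} (R : ArchimedeanOrderedField c ℓ₁ ℓ₂) where

  open ArchimedeanOrderedField R hiding (zero)
  open OrderedFieldProperties R
  open RandomSubsets R
  open SubsetOracles R
  open Expectations R
  open UniformityTesting R
  open Scales R

  inv-pos : ∀ n .{{_ : NonZero n}} → 0# < inv n
  inv-pos n with nonZero⇒#0 (trans (*-comm (inv n) (fromℕ n)) (fromℕ-inv n))
  ... | inj₁ inv<0 = ⊥-elim (inv-nonNeg n inv<0)
  ... | inj₂ 0<inv = 0<inv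

  ∣∣ᶠ-≥ : ∀ x → x ≤ ∣ x ∣ᶠ
  ∣∣ᶠ-≥ x = proj₁ (∨-supremum x (- x))

  ∣∣ᶠ-≥neg : ∀ x → - x ≤ ∣ x ∣ᶠ
  ∣∣ᶠ-≥neg x = proj₁ (proj₂ (∨-supremum x (- x)))

  ∣∣ᶠ-nonNeg : ∀ x → 0# ≤ ∣ x ∣ᶠ
  ∣∣ᶠ-nonNeg x = ≤-cases {x} {0#} (λ x≤0 → ≤-trans (0≤-x x≤0) (∣∣ᶠ-≥neg x)) (λ 0≤x → ≤-trans 0≤x (∣∣ᶠ-≥ x))

  ε : Carrier
  ε = inv 2 * inv 2

  lookup-⊤ : ∀ {n} (i : Fin n) → lookup ⊤ i ≡ true
  lookup-⊤ i = []=⇒lookup (∈⊤ {x = i})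

  weight-⊤ : ∀ {n} (i : Fin n) → weight ⊤ i ≈ inv n
  weight-⊤ {n} i rewrite lookup-⊤ i | ∣⊤∣≡n n = *-identityˡ (inv n)

  -- Each of the at least n/2 elements outside S has lost the mass 1/n.
  halfSupport-far : ∀ {n} .{{_ : NonZero n}} (S : Subset n) (ne : Nonempty S) (ne⊤ : Nonempty {n} ⊤) →
                    2 ℕ.* ∣ S ∣ ℕ.≤ n → ε ≤ distance (uniformOn S ne) (uniformOn ⊤ ne⊤)
  halfSupport-far {n} S ne ne⊤ 2∣S∣≤n = *-monoʳ-≤ (inv 2) (inv-nonNeg 2) (begin
    inv 2
      ≈⟨ *-identityʳ (inv 2) ⟨
    inv 2 * 1#
      ≈⟨ *-congˡ (fromℕ-inv n) ⟨
    inv 2 * (fromℕ n * inv n)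
      ≤⟨ *-monoʳ-≤ _ (inv-nonNeg 2) (*-monoˡ-≤ _ (inv-nonNeg n) (fromℕ-mono n≤2∣∁S∣)) ⟩
    inv 2 * (fromℕ (2 ℕ.* ∣ ∁ S ∣) * inv n)
      ≈⟨ *-congˡ (*-congʳ (fromℕ-* 2 ∣ ∁ S ∣)) ⟩
    inv 2 * (fromℕ 2 * fromℕ ∣ ∁ S ∣ * inv n)
      ≈⟨ solve 4 (λ x y z w → x :* (y :* z :* w) := y :* x :* (z :* w)) refl _ _ _ _ ⟩
    fromℕ 2 * inv 2 * (fromℕ ∣ ∁ S ∣ * inv n)
      ≈⟨ trans (*-congʳ (fromℕ-inv 2)) (*-identityˡ _) ⟩
    fromℕ ∣ ∁ S ∣ * inv n
      ≈⟨ *-congʳ (sum-𝟙 (∁ S)) ⟨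
    sum (λ i → 𝟙 (lookup (∁ S) i)) * inv n
      ≈⟨ *-distribʳ-sum (inv n) (λ i → 𝟙 (lookup (∁ S) i)) ⟩
    sum (λ i → 𝟙 (lookup (∁ S) i) * inv n)
      ≤⟨ sum-mono pointwise ⟩
    sum (λ i → ∣ weight S i - weight ⊤ i ∣ᶠ) ∎)
    where
    open ≤-Reasoning
    n≤2∣∁S∣ : n ℕ.≤ 2 ℕ.* ∣ ∁ S ∣
    n≤2∣∁S∣ rewrite ∣∁p∣≡n∸∣p∣ S | ℕₚ.*-distribˡ-∸ 2 n ∣ S ∣ = ℕₚ.m+n≤o⇒m≤o∸n n
      (ℕₚ.≤-trans (ℕₚ.+-monoʳ-≤ n 2∣S∣≤n) (ℕₚ.≤-reflexive (≡.cong (n ℕ.+_) (≡.sym (ℕₚ.+-identityʳ n)))))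
    pointwise : ∀ i → 𝟙 (lookup (∁ S) i) * inv n ≤ ∣ weight S i - weight ⊤ i ∣ᶠ
    pointwise i rewrite lookup-map i not S with lookup S i
    ... | true  = ≤-trans (≤-reflexive (zeroˡ _)) (∣∣ᶠ-nonNeg _)
    ... | false = ≤-trans (≤-reflexive (begin-equality
      1# * inv n                             ≈⟨ trans (*-identityˡ _) (sym (weight-⊤ i)) ⟩
      weight ⊤ i                             ≈⟨ -‿involutive _ ⟨
      - - weight ⊤ i                         ≈⟨ -‿cong (trans (+-congʳ (zeroˡ (inv ∣ S ∣))) (+-identityˡ _)) ⟨
      - (0# * inv ∣ S ∣ - weight ⊤ i)        ∎)) (∣∣ᶠ-≥neg _)

  module _ {n t : ℕ} .{{_ : NonZero n}} {T : Tester n t} where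

    open Tester T

    accept-reject : ∀ O → acceptProb T O + rejectProb T O ≈ 1#
    accept-reject O = trans (sym (average-+ coin _ _)) (trans (average-cong coin λ ω →
      trans (sym (expectation-+ O (queries ω) _ _)) (trans
        (≤-antisym (expectation-mono O (queries ω) (≤-reflexive ∘ total ω))
                   (expectation-mono O (queries ω) (≤-reflexive ∘ sym ∘ total ω)))
        (expectation-const O (queries ω) 1#))) (average-const coin 1#))
      where
      total : ∀ ω js → (if accepts ω js then 1# else 0#) + (if accepts ω js then 0# else 1#) ≈ 1#
      total ω js with accepts ω js
      ... | true  = +-identityʳ 1#
      ... | false = +-identityˡ 1#

    accept-≤ : ∀ {δ} O → 1# - δ ≤ rejectProb T O → acceptProb T O ≤ δ
    accept-≤ {δ} O le = +-cancelʳ-≤ (1# - δ) (≤-trans (+-monoʳ-≤ _ le)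
      (≤-reflexive (trans (accept-reject O) (trans (sym (x-y+y≈x 1# δ)) (+-comm _ δ)))))

  module _ {n t : ℕ} .{{_ : NonZero n}} (T : Tester n t) (tester : IsUniformityTester ε (1/ 3) T) where

    open Tester T
    open IsUniformityTester tester

    ne⊤ : Nonempty {n} ⊤
    ne⊤ = inhabitant n , ∈⊤
      where
      inhabitant : ∀ n → .{{NonZero n}} → Fin n
      inhabitant (suc _) = zero

    -- The full set is large at every scale. Its answer is planted, which makes the planted
    -- set nonempty.
    paddedQueries : Fin #coins → Vec (Query n) (suc t)
    paddedQueries ω = (⊤ , ne⊤) ∷ queries ω

    errorAt : ℕ → Fin #coins → Carrier
    errorAt k ω = ErrorBound.totalError R (2 ℕ.^ k) {{2^-nonZero k}} (paddedQueries ω)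

    module _ (k : ℕ) (2^k≤n : 2 ℕ.^ k ℕ.≤ n) where

      open Planting R (2 ℕ.^ k) {{2^-nonZero k}}
      open ErrorBound R (2 ℕ.^ k) {{2^-nonZero k}}

      plant-nonempty : ∀ ω js S → Nonempty (plant (paddedQueries ω) js S)
      plant-nonempty ω (j ∷ js) S = j , lookup⇒[]= j _ (plant-monotone (queries ω) js _ j recorded)
        where
        ⊤-large : isLarge {n} ⊤ ≡ true
        ⊤-large with isLarge {n} ⊤ in eq
        ... | true  = ≡.refl
        ... | false = ⊥-elim (≡.subst IsTrue eq
          (ℕₚ.≤⇒≤ᵇ (ℕₚ.≤-trans 2^k≤n (ℕₚ.≤-reflexive (≡.sym (∣⊤∣≡n n))))))
        recorded : lookup (plantAnswer (isLarge {n} ⊤) j S) j ≡ true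
        recorded rewrite ⊤-large = lookup-insert j S

      admissible-accept : ∀ S → 𝟙 (admissible S) * acceptProb T (oracle S) ≤ inv 3
      admissible-accept S with nonempty? S | 2 ℕ.* ∣ S ∣ ℕ.≤ᵇ n in eq
      ... | no _   | _     = ≤-trans (≤-reflexive (zeroˡ _)) (inv-nonNeg 3)
      ... | yes _  | false = ≤-trans (≤-reflexive (zeroˡ _)) (inv-nonNeg 3)
      ... | yes ne | true  = ≤-trans (≤-reflexive (*-identityˡ _)) (accept-≤ {T = T} (oracle S)
        (soundness (uniformOn S ne) (uniformOn ⊤ ne⊤) (oracle S)
          (λ i → trans (weight-⊤ i) (sym (1/-irrelevant n)))
          (oracle-isConditional S ne)
          (halfSupport-far S ne ne⊤ (ℕₚ.≤ᵇ⇒≤ (2 ℕ.* ∣ S ∣) n (≡.subst IsTrue (≡.sym eq) tt)))))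

      -- The answer to the additional query is ignored, so that padding does not change the
      -- acceptance probability.
      accept-uniform : acceptProb T uniformOracle ≤ inv 3 + average coin (errorAt k)
      accept-uniform = begin
        average coin (λ ω → expectation uniformOracle (queries ω) (test ω))
          ≈⟨ average-cong coin (λ ω → average-const (uniformOn ⊤ ne⊤) _) ⟨
        average coin (λ ω → expectation uniformOracle (paddedQueries ω) (test ω ∘ tail))
          ≤⟨ average-mono coin (λ ω → indistinguishable (paddedQueries ω) (plant-nonempty ω)
               (test ω ∘ tail) (λ js → 𝟙-nonNeg (accepts ω (tail js))) (λ js → 𝟙-≤1 (accepts ω (tail js)))) ⟩
        average coin (λ ω → 𝔼 (accepted ω) + errorAt k ω)
          ≈⟨ average-+ coin _ _ ⟩
        average coin (λ ω → 𝔼 (accepted ω)) + average coin (errorAt k)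
          ≈⟨ +-congʳ (trans (sum-cong-≋ λ ω → sym (𝔼-* {n} (prob coin ω) (accepted ω)))
               (sym (𝔼-sum {n} λ ω S → prob coin ω * accepted ω S))) ⟩
        𝔼 (λ S → average coin (λ ω → accepted ω S)) + average coin (errorAt k)
          ≈⟨ +-congʳ (𝔼-cong {n} λ S → trans (average-* coin _ _) (*-congˡ (average-cong coin λ ω →
               average-const (oracle S (⊤ , ne⊤)) _))) ⟩
        𝔼 (λ S → 𝟙 (admissible S) * acceptProb T (oracle S)) + average coin (errorAt k)
          ≤⟨ +-monoˡ-≤ _ (≤-trans (𝔼-mono {n} admissible-accept) (≤-reflexive (𝔼-const {n} (inv 3)))) ⟩
        inv 3 + average coin (errorAt k) ∎
        where
        open ≤-Reasoning
        test : Fin #coins → Vec (Fin n) t → Carrier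
        test ω js = if accepts ω js then 1# else 0#
        accepted : Fin #coins → Subset n → Carrier
        accepted ω S = 𝟙 (admissible S) * expectation (oracle S) (paddedQueries ω) (test ω ∘ tail)

      -- The tester accepts the uniform distribution with probability at least 2/3, and the
      -- uniform distributions on admissible sets with probability at most 1/3.
      averageError-≥ : inv 3 ≤ average coin (errorAt k)
      averageError-≥ = +-cancelˡ-≤ (inv 3 + inv 3) (begin
        inv 3 + inv 3 + inv 3
          ≈⟨ trans (solve 1 (λ x → x :+ x :+ x := (con 1 :+ (con 1 :+ (con 1 :+ con 0))) :* x) refl (inv 3))
               (fromℕ-inv 3) ⟩
        1#
          ≈⟨ x-y+y≈x 1# (inv 3) ⟨
        1# - inv 3 + inv 3
          ≤⟨ +-monoˡ-≤ _ (completeness (uniformOn ⊤ ne⊤) uniformOracle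
               (λ i → trans (weight-⊤ i) (sym (1/-irrelevant n))) (uniformOracle-isConditional ne⊤)) ⟩
        acceptProb T uniformOracle + inv 3
          ≤⟨ +-monoˡ-≤ _ accept-uniform ⟩
        inv 3 + average coin (errorAt k) + inv 3
          ≈⟨ solve 2 (λ x y → x :+ y :+ x := x :+ x :+ y) refl _ _ ⟩
        inv 3 + inv 3 + average coin (errorAt k) ∎)
        where open ≤-Reasoning

    module _ {L : ℕ} (2^L≤n : 2 ℕ.^ L ℕ.≤ n) where

      2^k≤n : (k : Fin L) → 2 ℕ.^ toℕ k ℕ.≤ n
      2^k≤n k = ℕₚ.≤-trans (ℕₚ.^-monoʳ-≤ 2 (ℕₚ.<⇒≤ (toℕ<n k))) 2^L≤n

      sumRate : ∀ ω → sum {L} (λ k →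
        ErrorBound.totalRate R (2 ℕ.^ toℕ k) {{2^-nonZero (toℕ k)}} (paddedQueries ω)) ≤ fromℕ (rateTotal t)
      sumRate ω = begin
        sum {L} (λ k → sum {suc t} (λ i → rateAt (toℕ k) (size i)))
          ≈⟨ ∑-comm {L} {suc t} (λ k i → rateAt (toℕ k) (size i)) ⟩
        sum {suc t} (λ i → sum {L} (λ k → rateAt (toℕ k) (size i)))
          ≤⟨ sum-mono (λ i → sum-rate-≤4 (size i)
               {{nonempty⇒nonZero (proj₂ (lookup (paddedQueries ω) i))}} L) ⟩
        sum {suc t} (λ i → fromℕ 4)
          ≈⟨ trans (sum-const (suc t) (fromℕ 4)) (sym (fromℕ-* (suc t) 4)) ⟩
        fromℕ (rateTotal t) ∎
        where
        open ≤-Reasoning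
        size : Fin (suc t) → ℕ
        size i = ∣ proj₁ (lookup (paddedQueries ω) i) ∣

      sumSize : sum {L} (λ k → ErrorBound.sizeBound R (2 ℕ.^ toℕ k) {{2^-nonZero (toℕ k)}} {n} (suc t))
                ≤ fromℕ (sizeTotal t)
      sumSize = begin
        sum {L} (λ k → fromℕ 2 * inv (2 ℕ.^ toℕ k) + fromℕ 2 * (fromℕ (suc t) * inv n))
          ≤⟨ sum-mono (λ k → +-mono-≤ (*-monoʳ-≤ _ (fromℕ-nonNeg 2) (inv≤rate (toℕ k)))
               (*-monoʳ-≤ _ (fromℕ-nonNeg 2) (*-monoʳ-≤ _ (fromℕ-nonNeg (suc t)) (inv-n≤rate k)))) ⟩
        sum {L} (λ k → fromℕ 2 * rateAt (toℕ k) 1 + fromℕ 2 * (fromℕ (suc t) * rateAt (toℕ k) n))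
          ≈⟨ trans (∑-distrib-+ {L} _ _) (sym (+-cong (*-distribˡ-sum {L} _ _)
               (trans (*-congˡ (*-distribˡ-sum {L} _ _)) (*-distribˡ-sum {L} _ _)))) ⟩
        fromℕ 2 * sum {L} (λ k → rateAt (toℕ k) 1) + fromℕ 2 * (fromℕ (suc t) * sum {L} (λ k → rateAt (toℕ k) n))
          ≤⟨ +-mono-≤ (*-monoʳ-≤ _ (fromℕ-nonNeg 2) (sum-rate-≤4 1 L))
               (*-monoʳ-≤ _ (fromℕ-nonNeg 2) (*-monoʳ-≤ _ (fromℕ-nonNeg (suc t)) (sum-rate-≤4 n L))) ⟩
        fromℕ 2 * fromℕ 4 + fromℕ 2 * (fromℕ (suc t) * fromℕ 4)
          ≈⟨ trans (fromℕ-+ (2 ℕ.* 4) (2 ℕ.* (suc t ℕ.* 4))) (+-cong (fromℕ-* 2 4)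
               (trans (fromℕ-* 2 (suc t ℕ.* 4)) (*-congˡ (fromℕ-* (suc t) 4)))) ⟨
        fromℕ (sizeTotal t) ∎
        where
        open ≤-Reasoning
        x≤fromℕ*x : ∀ m .{{_ : NonZero m}} {x} → 0# ≤ x → x ≤ fromℕ m * x
        x≤fromℕ*x (suc m) {x = x} 0≤x = ≤-trans (x≤x+y (*-nonNeg (fromℕ-nonNeg m) 0≤x))
          (≤-reflexive (solve 2 (λ x m → x :+ m :* x := (con 1 :+ m) :* x) refl x (fromℕ m)))
        -- A query of size 1 has rate 1/M at the scale M = 2^k, also for M = 1.
        inv≤rate : ∀ k → inv (2 ℕ.^ k) ≤ rateAt k 1
        inv≤rate k with 2 ℕ.^ k ℕ.≤ᵇ 1 in eq
        ... | false = x≤fromℕ*x 1 (inv-nonNeg (2 ℕ.^ k))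
        ... | true  = ≤-trans (inv-anti {1} (ℕ.>-nonZero⁻¹ (2 ℕ.^ k) {{2^-nonZero k}}))
                        (x≤fromℕ*x (2 ℕ.^ k) {{2^-nonZero k}} (inv-nonNeg 1))
        -- A query of size n is large at every scale considered, with rate M/n.
        inv-n≤rate : ∀ (k : Fin L) → inv n ≤ rateAt (toℕ k) n
        inv-n≤rate k with 2 ℕ.^ toℕ k ℕ.≤ᵇ n in eq
        ... | true  = x≤fromℕ*x (2 ℕ.^ toℕ k) {{2^-nonZero (toℕ k)}} (inv-nonNeg n)
        ... | false = ⊥-elim (≡.subst IsTrue eq (ℕₚ.≤⇒≤ᵇ (2^k≤n k)))

      sumError : ∀ ω → sum {L} (λ k → errorAt (toℕ k) ω) ≤ fromℕ (errorTotal t)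
      sumError ω = begin
        sum {L} (λ k → N * (r k + (z k + N * r k)))
          ≈⟨ trans (sym (*-distribˡ-sum {L} N _)) (*-congˡ (trans (∑-distrib-+ {L} _ _) (+-congˡ
               (trans (∑-distrib-+ {L} _ _) (+-congˡ (sym (*-distribˡ-sum {L} N _))))))) ⟩
        N * (sum r + (sum z + N * sum r))
          ≤⟨ *-monoʳ-≤ N 0≤N (+-mono-≤ (sumRate ω) (+-mono-≤ sumSize (*-monoʳ-≤ N 0≤N (sumRate ω)))) ⟩
        N * (fromℕ (rateTotal t) + (fromℕ (sizeTotal t) + N * fromℕ (rateTotal t)))
          ≈⟨ trans (fromℕ-* (suc (suc t)) (rateTotal t ℕ.+ (sizeTotal t ℕ.+ suc (suc t) ℕ.* rateTotal t)))
               (*-congˡ (trans (fromℕ-+ (rateTotal t) (sizeTotal t ℕ.+ suc (suc t) ℕ.* rateTotal t))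
                 (+-congˡ (trans (fromℕ-+ (sizeTotal t) (suc (suc t) ℕ.* rateTotal t))
                   (+-congˡ (fromℕ-* (suc (suc t)) (rateTotal t))))))) ⟨
        fromℕ (errorTotal t) ∎
        where
        open ≤-Reasoning
        N : Carrier
        N = fromℕ (suc (suc t))
        0≤N : 0# ≤ N
        0≤N = fromℕ-nonNeg (suc (suc t))
        r z : Fin L → Carrier
        r k = ErrorBound.totalRate R (2 ℕ.^ toℕ k) {{2^-nonZero (toℕ k)}} (paddedQueries ω)
        z k = ErrorBound.sizeBound R (2 ℕ.^ toℕ k) {{2^-nonZero (toℕ k)}} {n} (suc t)

      -- The error is at least 1/3 at every scale, while its sum does not depend on the number
      -- of scales.
      scales-≤ : L ℕ.≤ errorTotal t ℕ.* 3
      scales-≤ = ℕₚ.≮⇒≥ λ lt → (begin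
        fromℕ L                                 ≈⟨ trans (*-congˡ (trans (*-comm _ _) (fromℕ-inv 3))) (*-identityʳ _) ⟨
        fromℕ L * (inv 3 * fromℕ 3)             ≈⟨ *-assoc _ _ _ ⟨
        fromℕ L * inv 3 * fromℕ 3               ≈⟨ *-congʳ (sum-const L (inv 3)) ⟨
        sum {L} (λ k → inv 3) * fromℕ 3         ≤⟨ *-monoˡ-≤ _ (fromℕ-nonNeg 3) (sum-mono λ k →
                                                     averageError-≥ (toℕ k) (2^k≤n k)) ⟩
        sum {L} (λ k → average coin (errorAt (toℕ k))) * fromℕ 3
          ≈⟨ *-congʳ (average-sum {m = L} coin (λ k → errorAt (toℕ k))) ⟨
        average coin (λ ω → sum {L} (λ k → errorAt (toℕ k) ω)) * fromℕ 3
          ≤⟨ *-monoˡ-≤ _ (fromℕ-nonNeg 3) (≤-trans (average-mono coin sumError)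
               (≤-reflexive (average-const coin (fromℕ (errorTotal t))))) ⟩
        fromℕ (errorTotal t) * fromℕ 3          ≈⟨ fromℕ-* (errorTotal t) 3 ⟨
        fromℕ (errorTotal t ℕ.* 3)              ∎) (fromℕ-mono-< lt)
        where open ≤-Reasoning

  -- If n were larger, there would be one scale more than the errors can account for.
  loglog-≤ : ∀ {n t} .{{_ : NonZero n}} (T : Tester n t) → IsUniformityTester ε (1/ 3) T →
             ⌈log₂ ⌈log₂ n ⌉ ⌉ ℕ.≤ 8 ℕ.+ 3 ℕ.* t
  loglog-≤ {n} {t} T tester = ⌈log₂⌉-≤ {k = 8 ℕ.+ 3 ℕ.* t}
    (ℕₚ.≤-trans (⌈log₂⌉-≤ {k = suc (errorTotal t ℕ.* 3)} n≤) (errorTotal-≤2^ t))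
    where
    n≤ : n ℕ.≤ 2 ℕ.^ suc (errorTotal t ℕ.* 3)
    n≤ = ℕₚ.≰⇒≥ λ 2^L≤n → ℕₚ.1+n≰n (scales-≤ T tester 2^L≤n)

theorem7p2p1 : ∀ {a ℓ₁ ℓ₂} (R : ArchimedeanOrderedField a ℓ₁ ℓ₂) →
    let open ArchimedeanOrderedField R
        open UniformityTesting R
    in ∃[ ε ] ∃[ c ] 0# < ε × 0# < c ×
       (∃[ N ] ∀ n .{{_ : NonZero n}} → N ℕ.≤ n →
         ∀ t (T : Tester n t) → IsUniformityTester ε (1/ 3) T →
         c * fromℕ ⌈log₂ ⌈log₂ n ⌉ ⌉ ≤ fromℕ t)
theorem7p2p1 R = ε , inv 11 , *-pos (inv-pos 2) (inv-pos 2) , inv-pos 11 , threshold 9 , bound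
  where
  open ArchimedeanOrderedField R hiding (zero)
  open OrderedFieldProperties R
  open UniformityTesting R
  open Testers R
  bound : ∀ n .{{_ : NonZero n}} → threshold 9 ℕ.≤ n → ∀ t (T : Tester n t) →
          IsUniformityTester ε (1/ 3) T → inv 11 * fromℕ ⌈log₂ ⌈log₂ n ⌉ ⌉ ≤ fromℕ t
  bound n large t T tester = begin
    inv 11 * fromℕ ⌈log₂ ⌈log₂ n ⌉ ⌉     ≤⟨ *-monoʳ-≤ _ (inv-nonNeg 11)
                                              (fromℕ-mono (≤8+3t⇒≤11t t (k≤loglog 9 large) (loglog-≤ T tester))) ⟩
    inv 11 * fromℕ (11 ℕ.* t)            ≈⟨ *-congˡ (fromℕ-* 11 t) ⟩
    inv 11 * (fromℕ 11 * fromℕ t)        ≈⟨ solve 3 (λ x y z → x :* (y :* z) := y :* x :* z) refl _ _ _ ⟩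
    fromℕ 11 * inv 11 * fromℕ t          ≈⟨ trans (*-congʳ (fromℕ-inv 11)) (*-identityˡ _) ⟩
    fromℕ t                              ∎
    where open ≤-Reasoning
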